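{- Let $f:\{0,1\}^n\to\{0,1\}$ be a non-constant Boolean function computed by a minimal read-$k$ DNF formula with $\alpha$ terms and maximum width $\beta$. Then \[ \widetilde{\deg}(f) \le O\!\left(k(k+1)^2(2k+1)^2\cdot\bigl(\mathsf{N}(f)\,\mathsf{N}(\overline f)\bigr)^6\right). \]
   Context: A DNF formula is an OR of terms, each term an AND of literals (variables or negated variables); it is read-$k$ if every variable appears in at most $k$ terms. The width of a term is its number of literals. A minimal DNF is one from which no term or literal can be removed without changing the computed function. $\mathsf{N}(f)$ is the minimum degree of a real polynomial $p$ with $|p(x)|\le 1/3$ whenever $f(x)=0$ and $|p(x)|\ge 1$ whenever $f(x)=1$ ($x\in\{0,1\}^n$); $\overline f=1-f$. $\widetilde{\deg}(f)$ is the minimum degree of a real polynomial $p$ with $|f(x)-p(x)|\le 1/3$ for all $x$. The $O(\cdot)$ hides an absolute constant.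
   Formalization: The polynomials in the definitions of the approximate degree and of N(f), N(1−f) are taken with rational instead of real coefficients (and multilinear); the minimum degrees are the same, since the constraints are finite linear systems with rational data. -}

module Defs where

open import Data.Bool using (Bool; true; false; if_then_else_; _∧_; _∨_; not; _≟_)
open import Data.Nat using (ℕ; zero; suc; _+_; _*_; _^_; _≤_; _<_)
open import Data.Fin using (Fin)
import Data.Fin as Fin
open import Data.Vec using (Vec; []; _∷_; lookup; count)
open import Data.List using (List; []; _∷_; length; removeAt; filter)
open import Data.Bool.ListAction using (any; all)
open import Data.Product using (_×_; _,_; proj₁; proj₂; ∃-syntax)
open import Data.Integer using (+_)
open import Data.Rational using (ℚ; 0ℚ; 1ℚ; ∣_∣) renaming (_+_ to _+ℚ_; _*_ to _*ℚ_; _-_ to _-ℚ_; _≤_ to _≤ℚ_; _/_ to _/ℚ_)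
open import Relation.Binary.PropositionalEquality using (_≡_)
open import Relation.Nullary using (¬_)
open import Relation.Nullary.Decidable using (⌊_⌋)

BoolFun : ℕ → Set
BoolFun n = Vec Bool n → Bool

IsConstant : ∀ {n} → BoolFun n → Set
IsConstant {n} f = ∀ (x y : Vec Bool n) → f x ≡ f y

compl : ∀ {n} → BoolFun n → BoolFun n
compl f x = not (f x)

Literal : ℕ → Set
Literal n = Fin n × Bool

Term : ℕ → Set
Term n = List (Literal n)

DNF : ℕ → Set
DNF n = List (Term n)

evalLit : ∀ {n} → Literal n → Vec Bool n → Bool
evalLit (i , true)  x = lookup x i
evalLit (i , false) x = not (lookup x i)

evalTerm : ∀ {n} → Term n → Vec Bool n → Bool
evalTerm t x = all (λ l → evalLit l x) t

evalDNF : ∀ {n} → DNF n → Vec Bool n → Bool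
evalDNF φ x = any (λ t → evalTerm t x) φ

Computes : ∀ {n} → DNF n → BoolFun n → Set
Computes {n} φ f = ∀ (x : Vec Bool n) → evalDNF φ x ≡ f x

SameFunction : ∀ {n} → DNF n → DNF n → Set
SameFunction {n} φ ψ = ∀ (x : Vec Bool n) → evalDNF φ x ≡ evalDNF ψ x

occursIn : ∀ {n} → Fin n → Term n → Bool
occursIn i t = any (λ l → ⌊ proj₁ l Data.Fin.≟ i ⌋) t

ReadK : ∀ {n} → ℕ → DNF n → Set
ReadK {n} k φ = ∀ (i : Fin n) → length (filter (λ t → occursIn i t Data.Bool.≟ true) φ) ≤ k

dropLiteral : ∀ {n} (φ : DNF n) (j : Fin (length φ)) → Fin (length (Data.List.lookup φ j)) → DNF n
dropLiteral (t ∷ φ) Fin.zero    m = removeAt t m ∷ φ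
dropLiteral (t ∷ φ) (Fin.suc j) m = t ∷ dropLiteral φ j m

Minimal : ∀ {n} → DNF n → Set
Minimal φ =
  (∀ (j : Fin (length φ)) → ¬ SameFunction (removeAt φ j) φ)
  × (∀ (j : Fin (length φ)) (m : Fin (length (Data.List.lookup φ j))) →
       ¬ SameFunction (dropLiteral φ j m) φ)

-- Multilinear polynomials over ℚ on {0,1}^n.
-- A polynomial is given by its coefficient for each monomial ∏_{i∈S} x_i,
-- the set S ⊆ [n] encoded by its indicator vector.

Poly : ℕ → Set
Poly n = Vec Bool n → ℚ

evalPoly : ∀ {n} → Poly n → Vec Bool n → ℚ
evalPoly {zero}  p []      = p []
evalPoly {suc n} p (b ∷ x) =
  evalPoly (λ S → p (false ∷ S)) x
  +ℚ (if b then evalPoly (λ S → p (true ∷ S)) x else 0ℚ)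

DegreeAtMost : ∀ {n} → ℕ → Poly n → Set
DegreeAtMost {n} d p = ∀ (S : Vec Bool n) → d < count (_≟ true) S → p S ≡ 0ℚ

toℚ : Bool → ℚ
toℚ true  = 1ℚ
toℚ false = 0ℚ

oneThird : ℚ
oneThird = + 1 /ℚ 3

Approximates : ∀ {n} → Poly n → BoolFun n → Set
Approximates {n} p f = ∀ (x : Vec Bool n) → ∣ toℚ (f x) -ℚ evalPoly p x ∣ ≤ℚ oneThird

NWitness : ∀ {n} → Poly n → BoolFun n → Set
NWitness {n} p f = ∀ (x : Vec Bool n) →
  (f x ≡ false → ∣ evalPoly p x ∣ ≤ℚ oneThird) × (f x ≡ true → 1ℚ ≤ℚ ∣ evalPoly p x ∣)

IsMinDegree : ∀ {n} → (Poly n → Set) → ℕ → Set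
IsMinDegree {n} P d =
  (∃[ p ] (DegreeAtMost d p × P p)) ×
  (∀ (e : ℕ) (p : Poly n) → DegreeAtMost e p → P p → d ≤ e)

IsApproxDeg : ∀ {n} → BoolFun n → ℕ → Set
IsApproxDeg f d = IsMinDegree (λ p → Approximates p f) d

IsNDeg : ∀ {n} → BoolFun n → ℕ → Set
IsNDeg f d = IsMinDegree (λ p → NWitness p f) d

{-# OPTIONS --safe #-}
-- Let L(d) = 16d².  A polynomial p of degree d on {0,1}^m with |p(0)| ≥ 1 and |p| ≤ 1/3 elsewhere
-- exists only for m ≤ L(d): its mean q(t) over independent bits of bias t is a univariate polynomial
-- with |q| ≤ (2/3) |q(0)| on [1/m, 1], and if m > 16d² then extrapolating to 0 from the nodes 1/m and
-- 16i²/m (1 ≤ i ≤ d) contradicts this.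
--
-- At a 1-input x (a 0-input, with b in place of a), a family of disjoint sensitive blocks of size ≤ s
-- has at most ks·L(a) members: since each block touches at most ks terms, a 1/(ks) fraction of the
-- family is independent, meaning that flipping any nonempty union of these blocks changes f, so that
-- x becomes an isolated point of a cube.  Minimal sensitive blocks are flipped to points where all
-- their variables are sensitive, so their size is at most kL(b), and there are at most k²L(a)L(b)
-- disjoint ones.  Hence 0-certificates have size at most k²L(a)L(b)·kL(a), and querying k²L(a)L(b)
-- of them in succession determines f, because each one yields a further disjoint block at every
-- remaining 1-input.  So f has exact degree at most k⁵L(a)³L(b)², which is O(k⁵a⁶b⁴).

module Submission where

open import Defs hiding (oneThird)
open import Defs using () renaming (oneThird to ⅓)
open import Algebra.Properties.CommutativeSemigroup using (interchange)
open import Data.Bool using (Bool; true; false; if_then_else_; not; _xor_; _∧_; _∨_)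
open import Data.Bool.ListAction using (any; all)
import Data.Bool.Properties as Boolₚ
open import Data.Empty using (⊥-elim)
open import Data.Fin using (Fin) renaming (zero to fzero; suc to fsuc)
import Data.Fin.Properties as Finₚ
open import Data.Fin.Properties using () renaming (_≟_ to _≟ᶠ_)
open import Data.List using (List; []; _∷_; length; allFin; filter; map; concatMap)
import Data.List.Membership.DecPropositional as DecMembership
open import Data.List.Membership.Propositional using (lose) renaming (_∈_ to _∈ˡ_)
open import Data.List.Membership.Propositional.Properties using (∈-allFin; ∈-filter⁺; ∈-filter⁻; ∈-concatMap⁺)
open import Data.List.Properties using (length-map; length-++)
open import Data.List.Relation.Binary.Sublist.Propositional using (_⊆_; []; _∷_; _∷ʳ_; ⊆-refl; ⊆-trans)
open import Data.List.Relation.Binary.Sublist.Propositional.Properties using (All-resp-⊆)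
open import Data.List.Relation.Unary.All as All using (All; []; _∷_)
import Data.List.Relation.Unary.All.Properties as Allₚ
open import Data.List.Relation.Unary.AllPairs as AllPairs using (AllPairs; []; _∷_)
import Data.List.Relation.Unary.AllPairs.Properties as AllPairsₚ
open import Data.List.Relation.Unary.Any using (here; there)
open import Data.List.Relation.Unary.Unique.Propositional.Properties using (allFin⁺)
open import Data.Nat using (ℕ; zero; suc; z≤n; s≤s; _+_; _*_; _^_; _∸_; _≤_; _<_)
import Data.Nat.Properties as ℕₚ
open import Data.Nat.Tactic.RingSolver using (solve-∀)
open import Data.Product using (_×_; _,_; proj₁; proj₂; ∃-syntax)
open import Data.Rational using (ℚ; 0ℚ; 1ℚ; ∣_∣; -_; 1/_; Positive; nonNegative; positive)
  renaming (_+_ to _+ℚ_; _*_ to _*ℚ_; _-_ to _-ℚ_; _≤_ to _≤ℚ_; _<_ to _<ℚ_)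
import Data.Rational.Properties as ℚₚ
open import Data.Rational.Solver using (module +-*-Solver)
open import Data.Sum using (_⊎_; inj₁; inj₂)
open import Data.Unit using (⊤; tt)
open import Data.Vec using (Vec; []; _∷_; lookup; replicate; tabulate; count; tail)
open import Data.Vec.Membership.Propositional using (_∈_)
open import Data.Vec.Properties using (lookup∘tabulate; tabulate∘lookup; tabulate-cong)
open import Data.Vec.Relation.Unary.Any using () renaming (here to ∈-here; there to ∈-there)
open import Function using (_∘_; id; case_of_)
open import Relation.Binary.PropositionalEquality using (_≡_; _≢_; refl; sym; trans; cong; cong₂; subst)
open import Relation.Nullary using (¬_; Dec; yes; no; does)
open import Relation.Nullary.Decidable using (⌊_⌋; _×-dec_)
open +-*-Solver using (solve; _:=_; _:+_; _:*_; _:-_; :-_; con)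

private variable
  X : Set
  ν : X → ℚ
  g h : X → ℚ

-- Extrapolation of univariate polynomials

2ℚ 4ℚ 16ℚ : ℚ
2ℚ = 1ℚ +ℚ 1ℚ
4ℚ = 2ℚ *ℚ 2ℚ
16ℚ = 4ℚ *ℚ 4ℚ

0≤+ : ∀ {p q} → 0ℚ ≤ℚ p → 0ℚ ≤ℚ q → 0ℚ ≤ℚ p +ℚ q
0≤+ {p} {q} 0≤p 0≤q = subst (_≤ℚ p +ℚ q) (ℚₚ.+-identityˡ 0ℚ) (ℚₚ.+-mono-≤ 0≤p 0≤q)

*-monoˡ : ∀ {r p q} → 0ℚ ≤ℚ r → p ≤ℚ q → r *ℚ p ≤ℚ r *ℚ q
*-monoˡ {r} 0≤r p≤q = ℚₚ.*-monoˡ-≤-nonNeg r {{nonNegative 0≤r}} p≤q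

0≤* : ∀ {p q} → 0ℚ ≤ℚ p → 0ℚ ≤ℚ q → 0ℚ ≤ℚ p *ℚ q
0≤* {p} {q} 0≤p 0≤q = subst (_≤ℚ p *ℚ q) (ℚₚ.*-zeroʳ p) (*-monoˡ 0≤p 0≤q)

*-mono : ∀ {p q r s} → 0ℚ ≤ℚ r → 0ℚ ≤ℚ q → p ≤ℚ q → r ≤ℚ s → p *ℚ r ≤ℚ q *ℚ s
*-mono {p} {q} {r} {s} 0≤r 0≤q p≤q r≤s = ℚₚ.≤-trans
  (ℚₚ.*-monoʳ-≤-nonNeg r {{nonNegative 0≤r}} p≤q) (*-monoˡ 0≤q r≤s)

p≤p+q : ∀ {p q r} → 0ℚ ≤ℚ q → r ≡ p +ℚ q → p ≤ℚ r
p≤p+q {p} {q} 0≤q refl = subst (_≤ℚ p +ℚ q) (ℚₚ.+-identityʳ p) (ℚₚ.+-monoʳ-≤ p 0≤q)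

0≤q-p : ∀ {p q} → p ≤ℚ q → 0ℚ ≤ℚ q -ℚ p
0≤q-p {p} {q} p≤q = subst (_≤ℚ q -ℚ p) (ℚₚ.+-inverseʳ p) (ℚₚ.+-monoˡ-≤ (- p) p≤q)

ι : ℕ → ℚ
ι zero    = 0ℚ
ι (suc i) = 1ℚ +ℚ ι i

sq : ℕ → ℚ
sq i = ι i *ℚ ι i

0≤1 : 0ℚ ≤ℚ 1ℚ
0≤1 = ℚₚ.nonNegative⁻¹ 1ℚ

0≤2 : 0ℚ ≤ℚ 2ℚ
0≤2 = ℚₚ.nonNegative⁻¹ 2ℚ

0≤ι : ∀ i → 0ℚ ≤ℚ ι i
0≤ι zero    = ℚₚ.≤-refl
0≤ι (suc i) = 0≤+ 0≤1 (0≤ι i)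

ι-mono : ∀ {i j} → i ≤ j → ι i ≤ℚ ι j
ι-mono {j = j} z≤n = 0≤ι j
ι-mono (s≤s i≤j) = ℚₚ.+-monoʳ-≤ 1ℚ (ι-mono i≤j)

-- Polynomials in the quantity ν, in Horner form; the degree is strictly below d.
PolyIn : (X → ℚ) → ℕ → (X → ℚ) → Set
PolyIn ν zero    g = ∀ x → g x ≡ 0ℚ
PolyIn ν (suc d) g = ∃[ c ] ∃[ h ] (PolyIn ν d h × (∀ x → g x ≡ c +ℚ ν x *ℚ h x))

poly-cong : ∀ d → (∀ x → h x ≡ g x) → PolyIn ν d g → PolyIn ν d h
poly-cong zero    e p               = λ x → trans (e x) (p x)
poly-cong (suc d) e (c , r , p , q) = c , r , p , λ x → trans (e x) (q x)

poly-0 : ∀ d → PolyIn ν d (λ _ → 0ℚ)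
poly-0 zero = λ _ → refl
poly-0 {ν = ν} (suc d) = 0ℚ , (λ _ → 0ℚ) , poly-0 d , λ x →
  solve 1 (λ a → con 0ℚ := con 0ℚ :+ a :* con 0ℚ) refl (ν x)

poly-const : ∀ d c → PolyIn ν (suc d) (λ _ → c)
poly-const {ν = ν} d c = c , (λ _ → 0ℚ) , poly-0 d , λ x →
  solve 2 (λ c a → c := c :+ a :* con 0ℚ) refl c (ν x)

poly-+ : ∀ d → PolyIn ν d g → PolyIn ν d h → PolyIn ν d (λ x → g x +ℚ h x)
poly-+ zero p q x = cong₂ _+ℚ_ (p x) (q x)
poly-+ {ν = ν} (suc d) (c , r , p , e) (c′ , r′ , p′ , e′) =
  c +ℚ c′ , (λ x → r x +ℚ r′ x) , poly-+ d p p′ , λ x → trans (cong₂ _+ℚ_ (e x) (e′ x))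
    (solve 5 (λ c c′ a b b′ → (c :+ a :* b) :+ (c′ :+ a :* b′) := (c :+ c′) :+ a :* (b :+ b′))
      refl c c′ (ν x) (r x) (r′ x))

poly-scale : ∀ d s → PolyIn ν d g → PolyIn ν d (λ x → s *ℚ g x)
poly-scale zero s p x = trans (cong (s *ℚ_) (p x)) (ℚₚ.*-zeroʳ s)
poly-scale {ν = ν} (suc d) s (c , r , p , e) =
  s *ℚ c , (λ x → s *ℚ r x) , poly-scale d s p , λ x → trans (cong (s *ℚ_) (e x))
    (solve 4 (λ s c a b → s :* (c :+ a :* b) := s :* c :+ a :* (s :* b)) refl s c (ν x) (r x))

poly-suc : ∀ d → PolyIn ν d g → PolyIn ν (suc d) g
poly-suc {ν = ν} zero p = 0ℚ , (λ _ → 0ℚ) , (λ _ → refl) , λ x → trans (p x)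
  (solve 1 (λ a → con 0ℚ := con 0ℚ :+ a :* con 0ℚ) refl (ν x))
poly-suc (suc d) (c , r , p , e) = c , r , poly-suc d p , e

poly-var : ∀ d → PolyIn ν d g → PolyIn ν (suc d) (λ x → ν x *ℚ g x)
poly-var {g = g} d p = 0ℚ , g , p , λ x → sym (ℚₚ.+-identityˡ _)

-- Sampling at t = s i² in this way turns a polynomial in t into one in `sq`; every occurrence of
-- the variable contributes a factor s, absorbed into the coefficients.
poly-comp : ∀ {Y : Set} {ν′ : Y → ℚ} d s (f : Y → X) → (∀ y → ν (f y) ≡ s *ℚ ν′ y) →
  PolyIn ν d g → PolyIn ν′ d (g ∘ f)
poly-comp zero s f e p y = p (f y)
poly-comp {ν′ = ν′} (suc d) s f e (c , r , p , q) =
  c , (λ y → s *ℚ r (f y)) , poly-scale d s (poly-comp d s f e p) , λ y →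
    trans (q (f y)) (cong (c +ℚ_) (trans (cong (_*ℚ r (f y)) (e y))
      (solve 3 (λ s a b → s :* a :* b := a :* (s :* b)) refl s (ν′ y) (r (f y)))))

-- Synthetic division by t - u: from q(t) = c + t r(t) and r(t) = r(u) + (t - u) h(t), the quotient
-- for q is r(t) + u h(t).
divide : ∀ d {q : ℚ → ℚ} → PolyIn id (suc d) q → ∀ u →
  ∃[ h ] (PolyIn id d h × (∀ t → q t ≡ q u +ℚ (t -ℚ u) *ℚ h t))
divide zero {q} (c , r , p , e) u = (λ _ → 0ℚ) , (λ _ → refl) , λ t →
  trans (const t) (trans (sym (const u)) (solve 3 (λ a t u → a := a :+ (t :- u) :* con 0ℚ) refl (q u) t u))
  where
  const : ∀ t → q t ≡ c
  const t = trans (e t) (trans (cong (λ z → c +ℚ t *ℚ z) (p t))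
              (solve 2 (λ c t → c :+ t :* con 0ℚ := c) refl c t))
divide (suc d) (c , r , p , e) u with divide d p u
... | h , ph , eh = (λ t → r t +ℚ u *ℚ h t) ,
  poly-+ (suc d) p (poly-suc d (poly-scale d u ph)) , λ t →
    trans (e t) (trans (solve 6 (λ c t u rt ru ht →
        c :+ t :* rt := (c :+ u :* ru) :+ ((t :- u) :* rt :+ u :* (rt :- ru))) refl c t u (r t) (r u) (h t))
      (cong₂ _+ℚ_ (sym (e u)) (trans (cong (λ z → (t -ℚ u) *ℚ r t +ℚ u *ℚ (z -ℚ r u)) (eh t))
        (solve 5 (λ t u rt ru ht → (t :- u) :* rt :+ u :* ((ru :+ (t :- u) :* ht) :- ru)
            := (t :- u) :* (rt :+ u :* ht)) refl t u (r t) (r u) (h t)))))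

-- Sequences r : ℕ → ℚ are read as even functions on ℤ, so the left neighbour of 0 is 1.

prev : (ℕ → ℚ) → ℕ → ℚ
prev r zero    = r 1
prev r (suc i) = r i

near : (ℕ → ℚ) → ℕ → ℚ
near r i = r (suc i) +ℚ prev r i

-- The difference of the two neighbours is odd in i; the factor i makes it even, hence again a
-- polynomial in i² when r is one.
slope : (ℕ → ℚ) → ℕ → ℚ
slope r i = ι i *ℚ (r (suc i) -ℚ prev r i)

-- The negated second central difference. With this sign its adjoint under alternating summation has
-- nonnegative coefficients.
δ² : (ℕ → ℚ) → ℕ → ℚ
δ² r i = (r i +ℚ r i) -ℚ near r i

module _ (c : ℚ) (r s : ℕ → ℚ) (e : ∀ i → r i ≡ c +ℚ sq i *ℚ s i) where

  prev-step : ∀ i → prev r i ≡ c +ℚ (ι i -ℚ 1ℚ) *ℚ (ι i -ℚ 1ℚ) *ℚ prev s i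
  -- The left neighbour of 0 is r 1, and (0 - 1)² = 1, so the formula for i - 1 still fits.
  prev-step zero    = e 1
  prev-step (suc i) = trans (e i) (solve 3 (λ c j b →
    c :+ j :* j :* b := c :+ ((con 1ℚ :+ j) :- con 1ℚ) :* ((con 1ℚ :+ j) :- con 1ℚ) :* b) refl c (ι i) (s i))

  near-step : ∀ i → near r i ≡ (c +ℚ c) +ℚ (sq i *ℚ near s i +ℚ (near s i +ℚ 2ℚ *ℚ slope s i))
  near-step i = trans (cong₂ _+ℚ_ (e (suc i)) (prev-step i)) (solve 4 (λ c j a b →
    (c :+ (con 1ℚ :+ j) :* (con 1ℚ :+ j) :* a) :+ (c :+ (j :- con 1ℚ) :* (j :- con 1ℚ) :* b)
      := (c :+ c) :+ (j :* j :* (a :+ b) :+ ((a :+ b) :+ con 2ℚ :* (j :* (a :- b)))))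
    refl c (ι i) (s (suc i)) (prev s i))

  slope-step : ∀ i → slope r i ≡ sq i *ℚ slope s i +ℚ (slope s i +ℚ 2ℚ *ℚ (sq i *ℚ near s i))
  slope-step i = trans (cong (ι i *ℚ_) (cong₂ _-ℚ_ (e (suc i)) (prev-step i))) (solve 4 (λ c j a b →
    j :* ((c :+ (con 1ℚ :+ j) :* (con 1ℚ :+ j) :* a) :- (c :+ (j :- con 1ℚ) :* (j :- con 1ℚ) :* b))
      := j :* j :* (j :* (a :- b)) :+ (j :* (a :- b) :+ con 2ℚ :* (j :* j :* (a :+ b))))
    refl c (ι i) (s (suc i)) (prev s i))

  δ²-step : ∀ i → δ² r i ≡ sq i *ℚ δ² s i +ℚ (- 1ℚ) *ℚ (near s i +ℚ 2ℚ *ℚ slope s i)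
  δ²-step i = trans (cong₂ (λ x y → (x +ℚ x) -ℚ y) (e i) (near-step i)) (solve 5 (λ c z w n l →
    ((c :+ z :* w) :+ (c :+ z :* w)) :- ((c :+ c) :+ (z :* n :+ (n :+ con 2ℚ :* l)))
      := z :* ((w :+ w) :- n) :+ con (- 1ℚ) :* (n :+ con 2ℚ :* l))
    refl c (sq i) (s i) (near s i) (slope s i))

-- The recurrences for `near` and `slope` refer to each other, so one induction over the Horner form
-- gives both degree bounds.
near-slope-poly : ∀ d {r} → PolyIn sq d r → PolyIn sq d (near r) × PolyIn sq d (slope r)
near-slope-poly zero {r} p =
  (λ i → cong₂ _+ℚ_ (p (suc i)) (prev0 i)) ,
  (λ i → trans (cong (ι i *ℚ_) (cong₂ _-ℚ_ (p (suc i)) (prev0 i))) (ℚₚ.*-zeroʳ (ι i)))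
  where
  prev0 : ∀ i → prev r i ≡ 0ℚ
  prev0 zero    = p 1
  prev0 (suc i) = p i
near-slope-poly (suc d) {r} (c , s , p , e) with near-slope-poly d p
... | pn , pl =
  poly-cong (suc d) (near-step c r s e)
    (poly-+ (suc d) (poly-const d (c +ℚ c)) (poly-+ (suc d) (poly-var d pn)
      (poly-suc d (poly-+ d pn (poly-scale d 2ℚ pl))))) ,
  poly-cong (suc d) (slope-step c r s e)
    (poly-+ (suc d) (poly-var d pl) (poly-+ (suc d) (poly-suc d pl)
      (poly-scale (suc d) 2ℚ (poly-var d pn))))

-- In `δ²-step` the constant cancels. The remaining terms have at most the degree of s, because in
-- i² δ² s the factor i² is compensated by the drop for s.
δ²-poly : ∀ d {r} → PolyIn sq (suc d) r → PolyIn sq d (δ² r)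
δ²-poly d {r} (c , s , p , e) with near-slope-poly d p
... | pn , pl = poly-cong d (δ²-step c r s e)
  (poly-+ d (lower d p) (poly-scale d (- 1ℚ) (poly-+ d pn (poly-scale d 2ℚ pl))))
  where
  lower : ∀ d → PolyIn sq d s → PolyIn sq d (λ i → sq i *ℚ δ² s i)
  lower zero    p i = trans (cong (sq i *ℚ_) (cong₂ (λ x y → (x +ℚ x) -ℚ y) (p i) (proj₁ (near-slope-poly 0 p) i)))
                       (ℚₚ.*-zeroʳ (sq i))
  lower (suc d) p   = poly-var d (δ²-poly d p)

-- smooth is the adjoint of δ² for alternating sums; iterating it on the unit mass at 0
-- produces the central binomial coefficients binom(2d, d + i).

smooth : (ℕ → ℚ) → ℕ → ℚ
smooth w zero    = 2ℚ *ℚ (w 0 +ℚ w 1)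
smooth w (suc i) = w i +ℚ 2ℚ *ℚ w (suc i) +ℚ w (suc (suc i))

weight : ℕ → ℕ → ℚ
weight zero zero    = 1ℚ
weight zero (suc i) = 0ℚ
weight (suc d)      = smooth (weight d)

sgn : ℕ → ℚ
sgn zero    = 1ℚ
sgn (suc i) = - sgn i

-- The sum of (-1)^i w(i) r(i) over -N ≤ i ≤ N for even w and r, whence the factor 2 away from 0.
altSum : (ℕ → ℚ) → (ℕ → ℚ) → ℕ → ℚ
altSum w r zero    = w 0 *ℚ r 0
altSum w r (suc N) = altSum w r N +ℚ sgn (suc N) *ℚ (2ℚ *ℚ (w (suc N) *ℚ r (suc N)))

-- Summation by parts: moving the second difference from r to the weights leaves only boundary terms
-- at N and N + 1.
altSum-smooth : ∀ w r N → altSum (smooth w) r N ≡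
  altSum w (δ² r) N +ℚ sgn N *ℚ (2ℚ *ℚ (w N *ℚ r (suc N) +ℚ w (suc N) *ℚ r N))
altSum-smooth w r zero = solve 4 (λ w0 w1 r0 r1 →
  con 2ℚ :* (w0 :+ w1) :* r0 := w0 :* ((r0 :+ r0) :- (r1 :+ r1)) :+ con 1ℚ :* (con 2ℚ :* (w0 :* r1 :+ w1 :* r0)))
  refl (w 0) (w 1) (r 0) (r 1)
altSum-smooth w r (suc N) = trans
  (cong (_+ℚ sgn (suc N) *ℚ (2ℚ *ℚ (smooth w (suc N) *ℚ r (suc N)))) (altSum-smooth w r N))
  (solve 8 (λ a s w0 w1 w2 r0 r1 r2 →
  (a :+ s :* (con 2ℚ :* (w0 :* r1 :+ w1 :* r0))) :+ (:- s) :* (con 2ℚ :* ((w0 :+ con 2ℚ :* w1 :+ w2) :* r1))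
    := (a :+ (:- s) :* (con 2ℚ :* (w1 :* ((r1 :+ r1) :- (r2 :+ r0))))) :+
       (:- s) :* (con 2ℚ :* (w1 :* r2 :+ w2 :* r1)))
  refl (altSum w (δ² r) N) (sgn N) (w N) (w (suc N)) (w (suc (suc N))) (r N) (r (suc N)) (r (suc (suc N))))

weight-support : ∀ d i → suc d ≤ i → weight d i ≡ 0ℚ
weight-support zero    (suc i) _ = refl
weight-support (suc d) (suc i) (s≤s d<i) = cong₂ _+ℚ_
  (cong₂ (λ x y → x +ℚ 2ℚ *ℚ y) (weight-support d i d<i) (weight-support d (suc i) (ℕₚ.m≤n⇒m≤1+n d<i)))
  (weight-support d (suc (suc i)) (ℕₚ.m≤n⇒m≤1+n (ℕₚ.m≤n⇒m≤1+n d<i)))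

altSum-0 : ∀ w N {r} → PolyIn sq 0 r → altSum w r N ≡ 0ℚ
altSum-0 w zero    p = trans (cong (w 0 *ℚ_) (p 0)) (ℚₚ.*-zeroʳ (w 0))
altSum-0 w (suc N) p = trans
  (cong₂ (λ a b → a +ℚ sgn (suc N) *ℚ (2ℚ *ℚ (w (suc N) *ℚ b))) (altSum-0 w N p) (p (suc N)))
  (solve 2 (λ s w → con 0ℚ :+ s :* (con 2ℚ :* (w :* con 0ℚ)) := con 0ℚ) refl (sgn (suc N)) (w (suc N)))

-- Each `δ²` lowers the degree in i² by one, so d of them annihilate r. The boundary terms of each
-- summation by parts lie outside the support of the weights.
altSum-vanishes : ∀ d N {r} → d ≤ N → PolyIn sq d r → altSum (weight d) r N ≡ 0ℚ
altSum-vanishes zero N _ p = altSum-0 (weight 0) N p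
altSum-vanishes (suc d) N {r} d<N p = trans (altSum-smooth (weight d) r N) (trans
  (cong₂ (λ a b → a +ℚ sgn N *ℚ (2ℚ *ℚ b)) (altSum-vanishes d N (ℕₚ.<⇒≤ d<N) (δ²-poly d p))
    (cong₂ (λ a b → a *ℚ r (suc N) +ℚ b *ℚ r N)
      (weight-support d N d<N) (weight-support d (suc N) (ℕₚ.m≤n⇒m≤1+n d<N))))
  (solve 3 (λ s a b → con 0ℚ :+ s :* (con 2ℚ :* (con 0ℚ :* a :+ con 0ℚ :* b)) := con 0ℚ)
    refl (sgn N) (r (suc N)) (r N)))

0≤weight : ∀ d i → 0ℚ ≤ℚ weight d i
0≤weight zero    zero    = 0≤1
0≤weight zero    (suc i) = ℚₚ.≤-refl
0≤weight (suc d) zero    = 0≤* 0≤2 (0≤+ (0≤weight d 0) (0≤weight d 1))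
0≤weight (suc d) (suc i) =
  0≤+ (0≤+ (0≤weight d i) (0≤* 0≤2 (0≤weight d (suc i)))) (0≤weight d (suc (suc i)))

weight-anti : ∀ d i → weight d (suc i) ≤ℚ weight d i
weight-anti zero    zero    = 0≤1
weight-anti zero    (suc i) = ℚₚ.≤-refl
weight-anti (suc d) zero    = subst (smooth (weight d) 1 ≤ℚ_)
  (solve 2 (λ a b → a :+ con 2ℚ :* b :+ a := con 2ℚ :* (a :+ b)) refl (weight d 0) (weight d 1))
  (ℚₚ.+-monoʳ-≤ (weight d 0 +ℚ 2ℚ *ℚ weight d 1) (ℚₚ.≤-trans (weight-anti d 1) (weight-anti d 0)))
weight-anti (suc d) (suc i) = ℚₚ.+-mono-≤
  (ℚₚ.+-mono-≤ (weight-anti d i) (*-monoˡ 0≤2 (weight-anti d (suc i)))) (weight-anti d (suc (suc i)))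

weight≤ : ∀ d i → weight d i ≤ℚ weight d 0
weight≤ d zero    = ℚₚ.≤-refl
weight≤ d (suc i) = ℚₚ.≤-trans (weight-anti d i) (weight≤ d i)

1≤weight : ∀ d → 1ℚ ≤ℚ weight d 0
1≤weight zero    = ℚₚ.≤-refl
1≤weight (suc d) = ℚₚ.≤-trans (1≤weight d) (p≤p+q
  (0≤+ (0≤weight d 0) (0≤* 0≤2 (0≤weight d 1)))
  (solve 2 (λ a b → con 2ℚ :* (a :+ b) := a :+ (a :+ con 2ℚ :* b)) refl (weight d 0) (weight d 1)))

-- Index 0 is left out: r 0 is the value to be estimated from the others.
absSum : (ℕ → ℚ) → ℕ → ℚ
absSum r zero    = 0ℚ
absSum r (suc N) = absSum r N +ℚ ∣ r (suc N) ∣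

∣sgn∣ : ∀ i → ∣ sgn i ∣ ≡ 1ℚ
∣sgn∣ zero    = refl
∣sgn∣ (suc i) = trans (ℚₚ.∣-p∣≡∣p∣ (sgn i)) (∣sgn∣ i)

∣sgn*∣ : ∀ i p → ∣ sgn i *ℚ p ∣ ≡ ∣ p ∣
∣sgn*∣ i p = trans (ℚₚ.∣p*q∣≡∣p∣*∣q∣ (sgn i) p)
  (trans (cong (_*ℚ ∣ p ∣) (∣sgn∣ i)) (ℚₚ.*-identityˡ ∣ p ∣))

∣*∣ˡ : ∀ {p} q → 0ℚ ≤ℚ p → ∣ p *ℚ q ∣ ≡ p *ℚ ∣ q ∣
∣*∣ˡ {p} q 0≤p = trans (ℚₚ.∣p*q∣≡∣p∣*∣q∣ p q) (cong (_*ℚ ∣ q ∣) (ℚₚ.0≤p⇒∣p∣≡p 0≤p))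

altSum-bound : ∀ d r N →
  ∣ altSum (weight d) r N -ℚ weight d 0 *ℚ r 0 ∣ ≤ℚ weight d 0 *ℚ (2ℚ *ℚ absSum r N)
altSum-bound d r zero = ℚₚ.≤-reflexive (trans (cong ∣_∣ (ℚₚ.+-inverseʳ (weight d 0 *ℚ r 0)))
  (sym (ℚₚ.*-zeroʳ (weight d 0))))
altSum-bound d r (suc N) = begin
  ∣ (S +ℚ sgn (suc N) *ℚ T) -ℚ c ∣                   ≡⟨ cong ∣_∣ (swap S (sgn (suc N) *ℚ T) c) ⟩
  ∣ (S -ℚ c) +ℚ sgn (suc N) *ℚ T ∣                   ≤⟨ ℚₚ.∣p+q∣≤∣p∣+∣q∣ (S -ℚ c) (sgn (suc N) *ℚ T) ⟩
  ∣ S -ℚ c ∣ +ℚ ∣ sgn (suc N) *ℚ T ∣                  ≤⟨ ℚₚ.+-mono-≤ (altSum-bound d r N) last ⟩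
  w *ℚ (2ℚ *ℚ absSum r N) +ℚ w *ℚ (2ℚ *ℚ ∣ r (suc N) ∣) ≡⟨ collect w (absSum r N) ∣ r (suc N) ∣ ⟩
  w *ℚ (2ℚ *ℚ (absSum r N +ℚ ∣ r (suc N) ∣))          ∎
  where
  open ℚₚ.≤-Reasoning
  S = altSum (weight d) r N
  w = weight d 0
  c = w *ℚ r 0
  v = weight d (suc N)
  T = 2ℚ *ℚ (v *ℚ r (suc N))
  swap : ∀ a b c → (a +ℚ b) -ℚ c ≡ (a -ℚ c) +ℚ b
  swap = solve 3 (λ a b c → (a :+ b) :- c := (a :- c) :+ b) refl
  collect : ∀ a b c → a *ℚ (2ℚ *ℚ b) +ℚ a *ℚ (2ℚ *ℚ c) ≡ a *ℚ (2ℚ *ℚ (b +ℚ c))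
  collect = solve 3 (λ a b c → a :* (con 2ℚ :* b) :+ a :* (con 2ℚ :* c) := a :* (con 2ℚ :* (b :+ c))) refl
  exchange : ∀ a b → 2ℚ *ℚ (a *ℚ b) ≡ a *ℚ (2ℚ *ℚ b)
  exchange = solve 2 (λ a b → con 2ℚ :* (a :* b) := a :* (con 2ℚ :* b)) refl
  last : ∣ sgn (suc N) *ℚ T ∣ ≤ℚ w *ℚ (2ℚ *ℚ ∣ r (suc N) ∣)
  last = begin
    ∣ sgn (suc N) *ℚ T ∣          ≡⟨ ∣sgn*∣ (suc N) T ⟩
    ∣ T ∣                         ≡⟨ trans (∣*∣ˡ (v *ℚ r (suc N)) 0≤2) (cong (2ℚ *ℚ_) (∣*∣ˡ (r (suc N)) (0≤weight d (suc N)))) ⟩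
    2ℚ *ℚ (v *ℚ ∣ r (suc N) ∣)    ≤⟨ *-monoˡ 0≤2 (ℚₚ.*-monoʳ-≤-nonNeg ∣ r (suc N) ∣ {{ℚₚ.∣-∣-nonNeg (r (suc N))}} (weight≤ d (suc N))) ⟩
    2ℚ *ℚ (w *ℚ ∣ r (suc N) ∣)    ≡⟨ exchange w ∣ r (suc N) ∣ ⟩
    w *ℚ (2ℚ *ℚ ∣ r (suc N) ∣)    ∎

-- The d-fold central difference of r vanishes, and its weight at 0 is the largest.
value-at-0 : ∀ d {r} → PolyIn sq d r → ∣ r 0 ∣ ≤ℚ 2ℚ *ℚ absSum r d
value-at-0 d {r} p = ℚₚ.*-cancelˡ-≤-pos w {{positive 0<w}} (begin
  w *ℚ ∣ r 0 ∣                          ≡⟨ ∣*∣ˡ (r 0) (0≤weight d 0) ⟨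
  ∣ w *ℚ r 0 ∣                          ≡⟨ ℚₚ.∣-p∣≡∣p∣ (w *ℚ r 0) ⟨
  ∣ - (w *ℚ r 0) ∣                      ≡⟨ cong ∣_∣ (ℚₚ.+-identityˡ (- (w *ℚ r 0))) ⟨
  ∣ 0ℚ -ℚ w *ℚ r 0 ∣                    ≡⟨ cong (λ z → ∣ z -ℚ w *ℚ r 0 ∣) (altSum-vanishes d d ℕₚ.≤-refl p) ⟨
  ∣ altSum (weight d) r d -ℚ w *ℚ r 0 ∣ ≤⟨ altSum-bound d r d ⟩
  w *ℚ (2ℚ *ℚ absSum r d)               ∎)
  where
  open ℚₚ.≤-Reasoning
  w = weight d 0
  0<w : 0ℚ <ℚ w
  0<w = ℚₚ.<-≤-trans (ℚₚ.positive⁻¹ 1ℚ) (1≤weight d)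

odd : ℚ → ℚ
odd n = 2ℚ *ℚ n +ℚ 1ℚ

0<odd : ∀ N → 0ℚ <ℚ odd (ι N)
0<odd N = ℚₚ.<-≤-trans (ℚₚ.positive⁻¹ 1ℚ)
  (p≤p+q (0≤* 0≤2 (0≤ι N)) (ℚₚ.+-comm (2ℚ *ℚ ι N) 1ℚ))

-- Σ 2 / (4i² − 1) telescopes to 1 − 1 / (2N + 1).
telescope : ∀ {u B} → 0ℚ ≤ℚ u → ∀ r N →
  (∀ i → suc i ≤ N → (u *ℚ ∣ r (suc i) ∣) *ℚ (16ℚ *ℚ sq (suc i) -ℚ 1ℚ) ≤ℚ 2ℚ *ℚ B) →
  4ℚ *ℚ (odd (ι N) *ℚ (u *ℚ absSum r N)) ≤ℚ 2ℚ *ℚ (ι N *ℚ B)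
telescope {u} {B} 0≤u r zero _ = ℚₚ.≤-reflexive (solve 2 (λ u B →
  con 4ℚ :* ((con 2ℚ :* con 0ℚ :+ con 1ℚ) :* (u :* con 0ℚ)) := con 2ℚ :* (con 0ℚ :* B)) refl u B)
telescope {u} {B} 0≤u r (suc N) H = ℚₚ.*-cancelˡ-≤-pos (odd n) {{positive (0<odd N)}} (begin
  odd n *ℚ (4ℚ *ℚ (odd (1ℚ +ℚ n) *ℚ (u *ℚ (absSum r N +ℚ ∣ r (suc N) ∣))))
    ≡⟨ split n u (absSum r N) ∣ r (suc N) ∣ ⟩
  odd (1ℚ +ℚ n) *ℚ (4ℚ *ℚ (odd n *ℚ Y)) +ℚ x *ℚ (16ℚ *ℚ ((1ℚ +ℚ n) *ℚ (1ℚ +ℚ n)) -ℚ 4ℚ)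
    -- For i = N + 1, 4 (2i - 1)(2i + 1) = 16i² - 4, which is below the 16i² - 1 of the hypothesis;
    -- the difference 3x is given away.
    ≤⟨ ℚₚ.+-mono-≤ (*-monoˡ (ℚₚ.<⇒≤ (0<odd (suc N))) (telescope 0≤u r N (λ i i<N → H i (ℕₚ.m≤n⇒m≤1+n i<N))))
         (ℚₚ.≤-trans (p≤p+q (0≤* 0≤x 0≤3) (shift x (16ℚ *ℚ ((1ℚ +ℚ n) *ℚ (1ℚ +ℚ n))))) (H N ℕₚ.≤-refl)) ⟩
  odd (1ℚ +ℚ n) *ℚ (2ℚ *ℚ (n *ℚ B)) +ℚ 2ℚ *ℚ B
    ≡⟨ merge n B ⟩
  odd n *ℚ (2ℚ *ℚ ((1ℚ +ℚ n) *ℚ B)) ∎)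
  where
  open ℚₚ.≤-Reasoning
  n = ι N
  Y = u *ℚ absSum r N
  x = u *ℚ ∣ r (suc N) ∣
  3ℚ = 4ℚ -ℚ 1ℚ
  0≤3 : 0ℚ ≤ℚ 3ℚ
  0≤3 = ℚₚ.nonNegative⁻¹ 3ℚ
  0≤x : 0ℚ ≤ℚ x
  0≤x = 0≤* 0≤u (ℚₚ.0≤∣p∣ (r (suc N)))
  split : ∀ n u a b → odd n *ℚ (4ℚ *ℚ (odd (1ℚ +ℚ n) *ℚ (u *ℚ (a +ℚ b)))) ≡
    odd (1ℚ +ℚ n) *ℚ (4ℚ *ℚ (odd n *ℚ (u *ℚ a))) +ℚ (u *ℚ b) *ℚ (16ℚ *ℚ ((1ℚ +ℚ n) *ℚ (1ℚ +ℚ n)) -ℚ 4ℚ)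
  split = solve 4 (λ n u a b →
    let o = con 2ℚ :* n :+ con 1ℚ; o′ = con 2ℚ :* (con 1ℚ :+ n) :+ con 1ℚ in
    o :* (con 4ℚ :* (o′ :* (u :* (a :+ b)))) :=
    o′ :* (con 4ℚ :* (o :* (u :* a))) :+ (u :* b) :* (con 16ℚ :* ((con 1ℚ :+ n) :* (con 1ℚ :+ n)) :- con 4ℚ)) refl
  shift : ∀ x s → x *ℚ (s -ℚ 1ℚ) ≡ x *ℚ (s -ℚ 4ℚ) +ℚ x *ℚ 3ℚ
  shift = solve 2 (λ x s → x :* (s :- con 1ℚ) := x :* (s :- con 4ℚ) :+ x :* con 3ℚ) refl
  merge : ∀ n B → odd (1ℚ +ℚ n) *ℚ (2ℚ *ℚ (n *ℚ B)) +ℚ 2ℚ *ℚ B ≡ odd n *ℚ (2ℚ *ℚ ((1ℚ +ℚ n) *ℚ B))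
  merge = solve 2 (λ n B →
    let o = con 2ℚ :* n :+ con 1ℚ; o′ = con 2ℚ :* (con 1ℚ :+ n) :+ con 1ℚ in
    o′ :* (con 2ℚ :* (n :* B)) :+ con 2ℚ :* B := o :* (con 2ℚ :* ((con 1ℚ :+ n) :* B))) refl

-- Writing q(t) = q(u) + (t - u) h(t), the bounds at u and at t = 16 u i² give u (16i² - 1) |h(t)| ≤
-- 2B. Since h has degree below d, its values at these d nodes control h(0), and the telescoping sum
-- yields |q(0)| < 3B/2.
extrapolate : ∀ d {q u B} → PolyIn id (suc d) q → 0ℚ ≤ℚ u → 0ℚ <ℚ B → ∣ q u ∣ ≤ℚ B →
  (∀ i → suc i ≤ d → ∣ q ((16ℚ *ℚ u) *ℚ sq (suc i)) ∣ ≤ℚ B) →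
  2ℚ *ℚ ∣ q 0ℚ ∣ <ℚ (2ℚ +ℚ 1ℚ) *ℚ B
extrapolate d {q} {u} {B} p 0≤u 0<B Hu H with divide d p u
... | h , ph , e = begin-strict
  2ℚ *ℚ ∣ q 0ℚ ∣                          ≤⟨ *-monoˡ 0≤2 q0 ⟩
  2ℚ *ℚ (B +ℚ u *ℚ (2ℚ *ℚ absSum r d))    ≡⟨ regroup B u (absSum r d) ⟩
  2ℚ *ℚ B +ℚ 4ℚ *ℚ Y                      <⟨ ℚₚ.+-monoʳ-< (2ℚ *ℚ B) 4Y<B ⟩
  2ℚ *ℚ B +ℚ B                            ≡⟨ triple B ⟩
  (2ℚ +ℚ 1ℚ) *ℚ B                         ∎
  where
  open ℚₚ.≤-Reasoning
  r : ℕ → ℚ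
  r i = h ((16ℚ *ℚ u) *ℚ sq i)
  Y = u *ℚ absSum r d
  regroup : ∀ B u a → 2ℚ *ℚ (B +ℚ u *ℚ (2ℚ *ℚ a)) ≡ 2ℚ *ℚ B +ℚ 4ℚ *ℚ (u *ℚ a)
  regroup = solve 3 (λ B u a → con 2ℚ :* (B :+ u :* (con 2ℚ :* a)) := con 2ℚ :* B :+ con 4ℚ :* (u :* a)) refl
  triple : ∀ B → 2ℚ *ℚ B +ℚ B ≡ (2ℚ +ℚ 1ℚ) *ℚ B
  triple = solve 1 (λ B → con 2ℚ :* B :+ B := (con 2ℚ :+ con 1ℚ) :* B) refl
  r0 : ∣ h 0ℚ ∣ ≤ℚ 2ℚ *ℚ absSum r d
  r0 = subst (λ z → ∣ h z ∣ ≤ℚ 2ℚ *ℚ absSum r d) (ℚₚ.*-zeroʳ (16ℚ *ℚ u))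
    (value-at-0 d (poly-comp d (16ℚ *ℚ u) (λ i → (16ℚ *ℚ u) *ℚ sq i) (λ _ → refl) ph))
  q0 : ∣ q 0ℚ ∣ ≤ℚ B +ℚ u *ℚ (2ℚ *ℚ absSum r d)
  q0 = begin
    ∣ q 0ℚ ∣                                ≡⟨ cong ∣_∣ (e 0ℚ) ⟩
    ∣ q u +ℚ (0ℚ -ℚ u) *ℚ h 0ℚ ∣            ≤⟨ ℚₚ.∣p+q∣≤∣p∣+∣q∣ (q u) ((0ℚ -ℚ u) *ℚ h 0ℚ) ⟩
    ∣ q u ∣ +ℚ ∣ (0ℚ -ℚ u) *ℚ h 0ℚ ∣        ≡⟨ cong (λ z → ∣ q u ∣ +ℚ ∣ z ∣)
      (solve 2 (λ u h → (con 0ℚ :- u) :* h := :- (u :* h)) refl u (h 0ℚ)) ⟩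
    ∣ q u ∣ +ℚ ∣ - (u *ℚ h 0ℚ) ∣            ≡⟨ cong (∣ q u ∣ +ℚ_) (trans (ℚₚ.∣-p∣≡∣p∣ (u *ℚ h 0ℚ)) (∣*∣ˡ (h 0ℚ) 0≤u)) ⟩
    ∣ q u ∣ +ℚ u *ℚ ∣ h 0ℚ ∣                ≤⟨ ℚₚ.+-mono-≤ Hu (*-monoˡ 0≤u r0) ⟩
    B +ℚ u *ℚ (2ℚ *ℚ absSum r d)            ∎
  0≤16sq-1 : ∀ i → 0ℚ ≤ℚ 16ℚ *ℚ sq (suc i) -ℚ 1ℚ
  0≤16sq-1 i = 0≤q-p (p≤p+q {1ℚ}
    (0≤+ (0≤* 0≤32 (0≤ι i)) (0≤+ (0≤* (ℚₚ.nonNegative⁻¹ 16ℚ) (0≤* (0≤ι i) (0≤ι i))) (ℚₚ.nonNegative⁻¹ (16ℚ -ℚ 1ℚ))))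
    (solve 1 (λ i → con 16ℚ :* ((con 1ℚ :+ i) :* (con 1ℚ :+ i)) :=
      con 1ℚ :+ (con 32ℚ :* i :+ (con 16ℚ :* (i :* i) :+ (con (16ℚ -ℚ 1ℚ))))) refl (ι i)))
    where
    32ℚ = 16ℚ +ℚ 16ℚ
    0≤32 : 0ℚ ≤ℚ 32ℚ
    0≤32 = ℚₚ.nonNegative⁻¹ 32ℚ
  node : ∀ i → suc i ≤ d → (u *ℚ ∣ r (suc i) ∣) *ℚ (16ℚ *ℚ sq (suc i) -ℚ 1ℚ) ≤ℚ 2ℚ *ℚ B
  node i i<d = begin
    (u *ℚ ∣ r (suc i) ∣) *ℚ k             ≡⟨ solve 3 (λ u r k → (u :* r) :* k := (u :* k) :* r) refl u ∣ r (suc i) ∣ k ⟩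
    (u *ℚ k) *ℚ ∣ r (suc i) ∣             ≡⟨ ∣*∣ˡ (r (suc i)) (0≤* 0≤u (0≤16sq-1 i)) ⟨
    ∣ (u *ℚ k) *ℚ r (suc i) ∣             ≡⟨ cong ∣_∣ (trans (expand u (sq (suc i)) (r (suc i)) (q u))
                                               (cong (_-ℚ q u) (sym (e t)))) ⟩
    ∣ q t -ℚ q u ∣                        ≤⟨ ℚₚ.∣p-q∣≤∣p∣+∣q∣ (q t) (q u) ⟩
    ∣ q t ∣ +ℚ ∣ q u ∣                    ≤⟨ ℚₚ.+-mono-≤ (H i i<d) Hu ⟩
    B +ℚ B                                ≡⟨ solve 1 (λ B → B :+ B := con 2ℚ :* B) refl B ⟩
    2ℚ *ℚ B                               ∎
    where
    k = 16ℚ *ℚ sq (suc i) -ℚ 1ℚ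
    t = (16ℚ *ℚ u) *ℚ sq (suc i)
    expand : ∀ u s r q → (u *ℚ (16ℚ *ℚ s -ℚ 1ℚ)) *ℚ r ≡ (q +ℚ ((16ℚ *ℚ u) *ℚ s -ℚ u) *ℚ r) -ℚ q
    expand = solve 4 (λ u s r q → (u :* (con 16ℚ :* s :- con 1ℚ)) :* r :=
      (q :+ ((con 16ℚ :* u) :* s :- u) :* r) :- q) refl
  4Y<B : 4ℚ *ℚ Y <ℚ B
  4Y<B = ℚₚ.*-cancelˡ-<-nonNeg (odd (ι d)) {{nonNegative (ℚₚ.<⇒≤ (0<odd d))}} (begin-strict
    odd (ι d) *ℚ (4ℚ *ℚ Y)       ≡⟨ solve 2 (λ o y → o :* (con 4ℚ :* y) := con 4ℚ :* (o :* y)) refl (odd (ι d)) Y ⟩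
    4ℚ *ℚ (odd (ι d) *ℚ Y)       ≤⟨ telescope 0≤u r d node ⟩
    2ℚ *ℚ (ι d *ℚ B)             ≡⟨ ℚₚ.+-identityʳ (2ℚ *ℚ (ι d *ℚ B)) ⟨
    -- The strict inequality comes from 2d < 2d + 1.
    2ℚ *ℚ (ι d *ℚ B) +ℚ 0ℚ       <⟨ ℚₚ.+-monoʳ-< (2ℚ *ℚ (ι d *ℚ B)) 0<B ⟩
    2ℚ *ℚ (ι d *ℚ B) +ℚ B        ≡⟨ solve 2 (λ n B → con 2ℚ :* (n :* B) :+ B := (con 2ℚ :* n :+ con 1ℚ) :* B) refl (ι d) B ⟩
    odd (ι d) *ℚ B               ∎)

-- Functions on the cube

pow : ℚ → ℕ → ℚ
pow p zero    = 1ℚ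
pow p (suc m) = p *ℚ pow p m

0≤pow : ∀ {p} m → 0ℚ ≤ℚ p → 0ℚ ≤ℚ pow p m
0≤pow zero    _   = 0≤1
0≤pow (suc m) 0≤p = 0≤* 0≤p (0≤pow m 0≤p)

-- (1 - t)(1 + (m + 1) t) = (1 + m t) - (m + 1) t², so each further factor can only lower the
-- product.
bernoulli : ∀ {t} m → 0ℚ ≤ℚ t → t ≤ℚ 1ℚ → pow (1ℚ -ℚ t) m *ℚ (1ℚ +ℚ ι m *ℚ t) ≤ℚ 1ℚ
bernoulli {t} zero 0≤t t≤1 = ℚₚ.≤-reflexive
  (solve 1 (λ t → con 1ℚ :* (con 1ℚ :+ con 0ℚ :* t) := con 1ℚ) refl t)
bernoulli {t} (suc m) 0≤t t≤1 = ℚₚ.≤-trans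
  (p≤p+q (0≤* (0≤* (0≤+ 0≤1 (0≤ι m)) (0≤* 0≤t 0≤t)) (0≤pow m (0≤q-p t≤1)))
    (solve 3 (λ t m v → v :* (con 1ℚ :+ m :* t) :=
      ((con 1ℚ :- t) :* v) :* (con 1ℚ :+ (con 1ℚ :+ m) :* t) :+ ((con 1ℚ :+ m) :* (t :* t)) :* v)
      refl t (ι m) (pow (1ℚ -ℚ t) m)))
  (bernoulli m 0≤t t≤1)

-- The degree is strictly below d.
DegBelow : ∀ {m} → ℕ → (Vec Bool m → ℚ) → Set
DegBelow {m}     zero    g = ∀ y → g y ≡ 0ℚ
DegBelow {zero}  (suc d) g = ⊤
DegBelow {suc m} (suc d) g =
  DegBelow (suc d) (λ y → g (false ∷ y)) × DegBelow d (λ y → g (true ∷ y) -ℚ g (false ∷ y))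

deg-cong : ∀ {m} d {g h : Vec Bool m → ℚ} → (∀ y → h y ≡ g y) → DegBelow d g → DegBelow d h
deg-cong         zero    e p       = λ y → trans (e y) (p y)
deg-cong {zero}  (suc d) e p       = tt
deg-cong {suc m} (suc d) e (p , q) =
  deg-cong (suc d) (λ y → e (false ∷ y)) p , deg-cong d (λ y → cong₂ _-ℚ_ (e (true ∷ y)) (e (false ∷ y))) q

deg-0 : ∀ m d → DegBelow {m} d (λ _ → 0ℚ)
deg-0 m       zero    = λ _ → refl
deg-0 zero    (suc d) = tt
deg-0 (suc m) (suc d) = deg-0 m (suc d) , deg-cong d (λ _ → refl) (deg-0 m d)

deg-const : ∀ m d c → DegBelow {m} (suc d) (λ _ → c)
deg-const zero    d c = tt
deg-const (suc m) d c = deg-const m d c , deg-cong d (λ _ → ℚₚ.+-inverseʳ c) (deg-0 m d)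

deg-+ : ∀ {m} d {g h : Vec Bool m → ℚ} → DegBelow d g → DegBelow d h → DegBelow d (λ y → g y +ℚ h y)
deg-+         zero    p q = λ y → cong₂ _+ℚ_ (p y) (q y)
deg-+ {zero}  (suc d) p q = tt
deg-+ {suc m} (suc d) {g} {h} (p , p′) (q , q′) = deg-+ (suc d) p q ,
  deg-cong d (λ y → solve 4 (λ a b c e → (a :+ b) :- (c :+ e) := (a :- c) :+ (b :- e)) refl
    (g (true ∷ y)) (h (true ∷ y)) (g (false ∷ y)) (h (false ∷ y))) (deg-+ d p′ q′)

deg-neg : ∀ {m} d {g : Vec Bool m → ℚ} → DegBelow d g → DegBelow d (λ y → 0ℚ -ℚ g y)
deg-neg         zero    p = λ y → cong (0ℚ -ℚ_) (p y)
deg-neg {zero}  (suc d) p = tt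
deg-neg {suc m} (suc d) {g} (p , p′) = deg-neg (suc d) p ,
  deg-cong d (λ y → solve 2 (λ a b → (con 0ℚ :- a) :- (con 0ℚ :- b) := con 0ℚ :- (a :- b)) refl
    (g (true ∷ y)) (g (false ∷ y))) (deg-neg d p′)

deg-suc : ∀ {m} d {g : Vec Bool m → ℚ} → DegBelow d g → DegBelow (suc d) g
deg-suc {m} zero p                = deg-cong 1 p (deg-0 m 1)
deg-suc {zero}  (suc d) p         = tt
deg-suc {suc m} (suc d) (p , p′)  = deg-suc (suc d) p , deg-suc d p′

deg-true : ∀ {m} d {g : Vec Bool (suc m) → ℚ} → DegBelow d g → DegBelow d (λ y → g (true ∷ y))
deg-true zero p = λ y → p (true ∷ y)
deg-true (suc d) {g} (p , p′) = deg-cong (suc d)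
  (λ y → solve 2 (λ a b → b := a :+ (b :- a)) refl (g (false ∷ y)) (g (true ∷ y)))
  (deg-+ (suc d) p (deg-suc d p′))

deg-false : ∀ {m} d {g : Vec Bool (suc m) → ℚ} → DegBelow d g → DegBelow d (λ y → g (false ∷ y))
deg-false zero    p       = λ y → p (false ∷ y)
deg-false (suc d) (p , _) = p

-- Constants, coordinates and negated coordinates, presented along the position of the coordinate so
-- that `deg-lit` can recurse. In `here`, e = true stands for negation.
data Lit : ∀ {m} → (Vec Bool m → Bool) → Set where
  fixed : ∀ {m} {c : Vec Bool m → Bool} e → (∀ y → c y ≡ e) → Lit c
  here  : ∀ {m} {c : Vec Bool (suc m) → Bool} e → (∀ b y → c (b ∷ y) ≡ b xor e) → Lit c
  there : ∀ {m} {c : Vec Bool (suc m) → Bool} {c′ : Vec Bool m → Bool} →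
          (∀ b y → c (b ∷ y) ≡ c′ y) → Lit c′ → Lit c

lit-lookup : ∀ {m} (i : Fin m) → Lit (λ y → lookup y i)
lit-lookup fzero    = here false λ { true y → refl ; false y → refl }
lit-lookup (fsuc i) = there (λ b y → refl) (lit-lookup i)

lit-not : ∀ {m} {c : Vec Bool m → Bool} → Lit c → Lit (λ y → not (c y))
lit-not (fixed e p) = fixed (not e) (λ y → cong not (p y))
lit-not (here e p)  = here (not e) λ b y → trans (cong not (p b y)) (not-xor b e)
  where
  not-xor : ∀ b e → not (b xor e) ≡ b xor not e
  not-xor true  e = refl
  not-xor false e = refl
lit-not (there p l) = there (λ b y → cong not (p b y)) (lit-not l)

if-cong : ∀ {a b : Bool} (x : ℚ) → a ≡ b → (if a then x else 0ℚ) ≡ (if b then x else 0ℚ)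
if-cong x refl = refl

-- At the coordinate of the literal one restriction of the product is 0, so the discrete derivative
-- is, up to sign, a restriction of g. At earlier coordinates the literal does not change and
-- commutes with the derivative.
deg-lit : ∀ {m} d {g : Vec Bool m → ℚ} {c : Vec Bool m → Bool} → Lit c → DegBelow d g →
  DegBelow (suc d) (λ y → if c y then g y else 0ℚ)
deg-lit {m} d {g} (fixed true  e) p = deg-cong (suc d) (λ y → if-cong (g y) (e y)) (deg-suc d p)
deg-lit {m} d {g} (fixed false e) p = deg-cong (suc d) (λ y → if-cong (g y) (e y)) (deg-0 m (suc d))
deg-lit {suc m} d {g} (here false e) p =
  deg-cong (suc d) (λ y → if-cong (g (false ∷ y)) (e false y)) (deg-0 m (suc d)) ,
  deg-cong d (λ y → trans (cong₂ _-ℚ_ (if-cong (g (true ∷ y)) (e true y)) (if-cong (g (false ∷ y)) (e false y)))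
    (ℚₚ.+-identityʳ (g (true ∷ y)))) (deg-true d p)
deg-lit {suc m} d {g} (here true e) p =
  deg-cong (suc d) (λ y → if-cong (g (false ∷ y)) (e false y)) (deg-suc d (deg-false d p)) ,
  deg-cong d (λ y → cong₂ _-ℚ_ (if-cong (g (true ∷ y)) (e true y)) (if-cong (g (false ∷ y)) (e false y)))
    (deg-neg d (deg-false d p))
deg-lit {suc m} zero {g} {c} (there e l) p =
  deg-cong 1 (λ y → zeroes (c (false ∷ y)) (p (false ∷ y))) (deg-0 m 1) ,
  λ y → cong₂ _-ℚ_ (zeroes (c (true ∷ y)) (p (true ∷ y))) (zeroes (c (false ∷ y)) (p (false ∷ y)))
  where
  zeroes : ∀ b {x} → x ≡ 0ℚ → (if b then x else 0ℚ) ≡ 0ℚ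
  zeroes true  e = e
  zeroes false _ = refl
deg-lit {suc m} (suc d) {g} (there {c′ = c′} e l) (p , p′) =
  deg-cong (suc (suc d)) (λ y → if-cong (g (false ∷ y)) (e false y)) (deg-lit (suc d) l p) ,
  deg-cong (suc d) (λ y → trans
    (cong₂ _-ℚ_ (if-cong (g (true ∷ y)) (e true y)) (if-cong (g (false ∷ y)) (e false y))) (if-diff (c′ y)))
    (deg-lit d l p′)
  where
  if-diff : ∀ b {x y} → (if b then x else 0ℚ) -ℚ (if b then y else 0ℚ) ≡ (if b then x -ℚ y else 0ℚ)
  if-diff true  = refl
  if-diff false = refl

-- The expectation of g over independent bits of bias t.
mean : ∀ {m} → (Vec Bool m → ℚ) → ℚ → ℚ
mean {zero}  g t = g []
mean {suc m} g t = mean (λ y → g (false ∷ y)) t +ℚ t *ℚ (mean (λ y → g (true ∷ y)) t -ℚ mean (λ y → g (false ∷ y)) t)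

mean-cong : ∀ {m} {g h : Vec Bool m → ℚ} → (∀ y → g y ≡ h y) → ∀ t → mean g t ≡ mean h t
mean-cong {zero}  e t = e []
mean-cong {suc m} e t = cong₂ (λ a b → a +ℚ t *ℚ (b -ℚ a))
  (mean-cong (λ y → e (false ∷ y)) t) (mean-cong (λ y → e (true ∷ y)) t)

mean-0 : ∀ m t → mean {m} (λ _ → 0ℚ) t ≡ 0ℚ
mean-0 zero    t = refl
mean-0 (suc m) t = trans (cong (λ a → a +ℚ t *ℚ (a -ℚ a)) (mean-0 m t))
  (solve 1 (λ t → con 0ℚ :+ t :* (con 0ℚ :- con 0ℚ) := con 0ℚ) refl t)

mean-diff : ∀ {m} (g h : Vec Bool m → ℚ) t → mean (λ y → g y -ℚ h y) t ≡ mean g t -ℚ mean h t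
mean-diff {zero}  g h t = refl
mean-diff {suc m} g h t = trans (cong₂ (λ a b → a +ℚ t *ℚ (b -ℚ a))
  (mean-diff (λ y → g (false ∷ y)) (λ y → h (false ∷ y)) t) (mean-diff (λ y → g (true ∷ y)) (λ y → h (true ∷ y)) t))
  (solve 5 (λ t a b c e → (a :- b) :+ t :* ((c :- e) :- (a :- b)) := (a :+ t :* (c :- a)) :- (b :+ t :* (e :- b)))
    refl t (mean (λ y → g (false ∷ y)) t) (mean (λ y → h (false ∷ y)) t)
    (mean (λ y → g (true ∷ y)) t) (mean (λ y → h (true ∷ y)) t))

-- Each discrete derivative in `mean` carries one factor t, so the degree in t does not exceed the
-- degree on the cube.
mean-poly : ∀ {m} d {g : Vec Bool m → ℚ} → DegBelow d g → PolyIn id d (mean g)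
mean-poly {m}     zero    p = λ t → trans (mean-cong p t) (mean-0 m t)
mean-poly {zero}  (suc d) {g} p = poly-const d (g [])
mean-poly {suc m} (suc d) {g} (p , p′) = poly-+ (suc d) (mean-poly (suc d) {λ y → g (false ∷ y)} p)
  (poly-var d (poly-cong d (λ t → sym (mean-diff (λ y → g (true ∷ y)) (λ y → g (false ∷ y)) t))
    (mean-poly d {λ y → g (true ∷ y) -ℚ g (false ∷ y)} p′)))

mean-at-0 : ∀ {m} (g : Vec Bool m → ℚ) → mean g 0ℚ ≡ g (replicate m false)
mean-at-0 {zero}  g = refl
mean-at-0 {suc m} g = trans
  (solve 2 (λ a b → a :+ con 0ℚ :* (b :- a) := a) refl (mean (λ y → g (false ∷ y)) 0ℚ) (mean (λ y → g (true ∷ y)) 0ℚ))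
  (mean-at-0 (λ y → g (false ∷ y)))

∣mix∣≤ : ∀ {t a b A B} → 0ℚ ≤ℚ t → t ≤ℚ 1ℚ → ∣ a ∣ ≤ℚ A → ∣ b ∣ ≤ℚ B →
  ∣ a +ℚ t *ℚ (b -ℚ a) ∣ ≤ℚ (1ℚ -ℚ t) *ℚ A +ℚ t *ℚ B
∣mix∣≤ {t} {a} {b} {A} {B} 0≤t t≤1 a≤ b≤ = begin
  ∣ a +ℚ t *ℚ (b -ℚ a) ∣              ≡⟨ cong ∣_∣ (solve 3 (λ t a b → a :+ t :* (b :- a) := (con 1ℚ :- t) :* a :+ t :* b) refl t a b) ⟩
  ∣ (1ℚ -ℚ t) *ℚ a +ℚ t *ℚ b ∣        ≤⟨ ℚₚ.∣p+q∣≤∣p∣+∣q∣ ((1ℚ -ℚ t) *ℚ a) (t *ℚ b) ⟩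
  ∣ (1ℚ -ℚ t) *ℚ a ∣ +ℚ ∣ t *ℚ b ∣    ≡⟨ cong₂ _+ℚ_ (∣*∣ˡ a (0≤q-p t≤1)) (∣*∣ˡ b 0≤t) ⟩
  (1ℚ -ℚ t) *ℚ ∣ a ∣ +ℚ t *ℚ ∣ b ∣    ≤⟨ ℚₚ.+-mono-≤ (*-monoˡ (0≤q-p t≤1) a≤) (*-monoˡ 0≤t b≤) ⟩
  (1ℚ -ℚ t) *ℚ A +ℚ t *ℚ B            ∎
  where open ℚₚ.≤-Reasoning

mean-bound : ∀ {m} {g : Vec Bool m → ℚ} {C t} → 0ℚ ≤ℚ t → t ≤ℚ 1ℚ → (∀ y → ∣ g y ∣ ≤ℚ C) → ∣ mean g t ∣ ≤ℚ C
mean-bound {zero}  _ _ H = H []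
mean-bound {suc m} {g} {C} {t} 0≤t t≤1 H = ℚₚ.≤-trans
  (∣mix∣≤ 0≤t t≤1 (mean-bound {g = λ y → g (false ∷ y)} 0≤t t≤1 (λ y → H (false ∷ y)))
    (mean-bound {g = λ y → g (true ∷ y)} 0≤t t≤1 (λ y → H (true ∷ y))))
  (ℚₚ.≤-reflexive (solve 2 (λ t C → (con 1ℚ :- t) :* C :+ t :* C := C) refl t C))

-- The origin has probability (1 - t)^m and is the only point where |g| may exceed C, there by at
-- most E.
mean-isolated : ∀ {m} {g : Vec Bool m → ℚ} {C E t} → 0ℚ ≤ℚ t → t ≤ℚ 1ℚ →
  ∣ g (replicate m false) ∣ ≤ℚ C +ℚ E → (∀ y → true ∈ y → ∣ g y ∣ ≤ℚ C) →
  ∣ mean g t ∣ ≤ℚ C +ℚ E *ℚ pow (1ℚ -ℚ t) m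
mean-isolated {zero} {g} {C} {E} _ _ H0 _ = subst (∣ g [] ∣ ≤ℚ_)
  (solve 2 (λ C E → C :+ E := C :+ E :* con 1ℚ) refl C E) H0
mean-isolated {suc m} {g} {C} {E} {t} 0≤t t≤1 H0 H = ℚₚ.≤-trans
  (∣mix∣≤ 0≤t t≤1
    (mean-isolated {g = λ y → g (false ∷ y)} 0≤t t≤1 H0 (λ y y≠0 → H (false ∷ y) (∈-there y≠0)))
    (mean-bound {g = λ y → g (true ∷ y)} 0≤t t≤1 (λ y → H (true ∷ y) (∈-here refl))))
  (ℚₚ.≤-reflexive (solve 4 (λ t C E v → (con 1ℚ :- t) :* (C :+ E :* v) :+ t :* C := C :+ E :* ((con 1ℚ :- t) :* v))
    refl t C E (pow (1ℚ -ℚ t) m)))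

⅔ : ℚ
⅔ = 2ℚ *ℚ ⅓

reciprocal : ∀ m → ∃[ u ] (0ℚ ≤ℚ u × ι (suc m) *ℚ u ≡ 1ℚ)
reciprocal m = (1/ ι (suc m)) {{nz}} ,
  ℚₚ.<⇒≤ (ℚₚ.positive⁻¹ _ {{ℚₚ.1/pos⇒pos (ι (suc m)) {{pos}}}}) ,
  ℚₚ.*-inverseʳ (ι (suc m)) {{nz}}
  where
  pos : Positive (ι (suc m))
  pos = positive (ℚₚ.<-≤-trans (ℚₚ.positive⁻¹ 1ℚ) (p≤p+q (0≤ι m) refl))
  nz = ℚₚ.pos⇒nonZero (ι (suc m)) {{pos}}

ι-+ : ∀ i j → ι (i + j) ≡ ι i +ℚ ι j
ι-+ zero    j = sym (ℚₚ.+-identityˡ (ι j))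
ι-+ (suc i) j = trans (cong (1ℚ +ℚ_) (ι-+ i j)) (sym (ℚₚ.+-assoc 1ℚ (ι i) (ι j)))

ι-* : ∀ i j → ι (i * j) ≡ ι i *ℚ ι j
ι-* zero    j = sym (ℚₚ.*-zeroˡ (ι j))
ι-* (suc i) j = trans (ι-+ j (i * j)) (trans (cong (ι j +ℚ_) (ι-* i j))
  (solve 2 (λ i j → j :+ i :* j := (con 1ℚ :+ i) :* j) refl (ι i) (ι j)))

-- With u = 1/m, the mean is at most 2M/3 on [u, 1], and it is M at 0.
isolated-point : ∀ {m} d {g : Vec Bool m → ℚ} → DegBelow (suc d) g →
  1ℚ ≤ℚ ∣ g (replicate m false) ∣ → (∀ y → true ∈ y → ∣ g y ∣ ≤ℚ ⅓) → m ≤ 16 * (d * d)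
isolated-point {zero}  d p H0 H = z≤n
isolated-point {suc m} d {g} p H0 H with suc m ℕₚ.≤? 16 * (d * d)
... | yes m≤ = m≤
... | no  m≰ with reciprocal m
...   | u , 0≤u , mu≡1 = ⊥-elim (ℚₚ.<-irrefl refl (begin-strict
  2ℚ *ℚ M              ≡⟨ cong (λ z → 2ℚ *ℚ ∣ z ∣) (mean-at-0 g) ⟨
  2ℚ *ℚ ∣ mean g 0ℚ ∣  <⟨ extrapolate d (mean-poly (suc d) {g} p) 0≤u 0<B (small u ℚₚ.≤-refl u≤1) node ⟩
  (2ℚ +ℚ 1ℚ) *ℚ B      ≡⟨ solve 1 (λ M → (con 2ℚ :+ con 1ℚ) :* (con ⅔ :* M) := con 2ℚ :* M) refl M ⟩
  2ℚ *ℚ M              ∎))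
  where
  open ℚₚ.≤-Reasoning
  M = ∣ g (replicate (suc m) false) ∣
  B = ⅔ *ℚ M
  0≤⅓ : 0ℚ ≤ℚ ⅓
  0≤⅓ = ℚₚ.nonNegative⁻¹ ⅓
  0≤⅔ : 0ℚ ≤ℚ ⅔
  0≤⅔ = ℚₚ.nonNegative⁻¹ ⅔
  0<B : 0ℚ <ℚ B
  0<B = ℚₚ.<-≤-trans (ℚₚ.positive⁻¹ ⅔) (subst (_≤ℚ B) (ℚₚ.*-identityʳ ⅔) (*-monoˡ 0≤⅔ H0))
  u≤1 : u ≤ℚ 1ℚ
  u≤1 = subst (u ≤ℚ_) mu≡1 (p≤p+q (0≤* (0≤ι m) 0≤u)
    (solve 2 (λ m u → (con 1ℚ :+ m) :* u := u :+ m :* u) refl (ι m) u))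
  small : ∀ t → u ≤ℚ t → t ≤ℚ 1ℚ → ∣ mean g t ∣ ≤ℚ B
  small t u≤t t≤1 = begin
    -- Here C = M/3, where M ≥ 1 turns the bound 1/3 into M/3, and the excess at the origin is E =
    -- 2M/3 = B.
    ∣ mean g t ∣                ≤⟨ mean-isolated {E = B} 0≤t t≤1
      (ℚₚ.≤-reflexive (solve 1 (λ M → M := con ⅓ :* M :+ con ⅔ :* M) refl M))
      (λ y y≠0 → ℚₚ.≤-trans (H y y≠0) (subst (_≤ℚ ⅓ *ℚ M) (ℚₚ.*-identityʳ ⅓) (*-monoˡ 0≤⅓ H0))) ⟩
    ⅓ *ℚ M +ℚ B *ℚ v            ≡⟨ solve 2 (λ M v →
      con ⅓ :* M :+ (con ⅔ :* M) :* v := (con ⅓ :* M) :* (con 1ℚ :+ v :* con 2ℚ)) refl M v ⟩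
    (⅓ *ℚ M) *ℚ (1ℚ +ℚ v *ℚ 2ℚ) ≤⟨ *-monoˡ (0≤* 0≤⅓ (ℚₚ.≤-trans 0≤1 H0)) (ℚₚ.+-monoʳ-≤ 1ℚ 2v≤1) ⟩
    (⅓ *ℚ M) *ℚ (1ℚ +ℚ 1ℚ)      ≡⟨ solve 1 (λ M → (con ⅓ :* M) :* (con 1ℚ :+ con 1ℚ) := con ⅔ :* M) refl M ⟩
    B                           ∎
    where
    v = pow (1ℚ -ℚ t) (suc m)
    0≤t = ℚₚ.≤-trans 0≤u u≤t
    -- Bernoulli's inequality with (m + 1) t ≥ (m + 1) u = 1.
    2v≤1 : v *ℚ 2ℚ ≤ℚ 1ℚ
    2v≤1 = ℚₚ.≤-trans (*-monoˡ (0≤pow (suc m) (0≤q-p t≤1)) (ℚₚ.+-monoʳ-≤ 1ℚ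
      (subst (_≤ℚ ι (suc m) *ℚ t) mu≡1 (*-monoˡ (0≤ι (suc m)) u≤t)))) (bernoulli (suc m) 0≤t t≤1)
  node : ∀ i → suc i ≤ d → ∣ mean g ((16ℚ *ℚ u) *ℚ sq (suc i)) ∣ ≤ℚ B
  -- The nodes lie in [u, 1]: 16 (i + 1)² ≥ 1, and 16 (i + 1)² u ≤ 16 d² u ≤ (m + 1) u = 1 by the
  -- assumption that m + 1 exceeds 16 d².
  node i i<d = small ((16ℚ *ℚ u) *ℚ sq (suc i))
    (p≤p+q (0≤* 0≤u (0≤+ (ℚₚ.nonNegative⁻¹ (16ℚ -ℚ 1ℚ)) (0≤* (ℚₚ.nonNegative⁻¹ 16ℚ) (0≤+ (0≤* 0≤2 (0≤ι i)) (0≤* (0≤ι i) (0≤ι i))))))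
      (solve 2 (λ u i → (con 16ℚ :* u) :* ((con 1ℚ :+ i) :* (con 1ℚ :+ i)) :=
        u :+ u :* ((con (16ℚ -ℚ 1ℚ)) :+ con 16ℚ :* (con 2ℚ :* i :+ i :* i))) refl u (ι i)))
    (begin
      (16ℚ *ℚ u) *ℚ sq (suc i)         ≤⟨ *-monoˡ (0≤* (ℚₚ.nonNegative⁻¹ 16ℚ) 0≤u)
        (*-mono (0≤ι (suc i)) (0≤ι d) (ι-mono i<d) (ι-mono i<d)) ⟩
      (16ℚ *ℚ u) *ℚ sq d               ≡⟨ solve 2 (λ u s → (con 16ℚ :* u) :* s := (con 16ℚ :* s) :* u) refl u (sq d) ⟩
      (16ℚ *ℚ sq d) *ℚ u               ≡⟨ cong (_*ℚ u) (trans (ι-* 16 (d * d)) (cong (16ℚ *ℚ_) (ι-* d d))) ⟨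
      ι (16 * (d * d)) *ℚ u            ≤⟨ ℚₚ.*-monoʳ-≤-nonNeg u {{nonNegative 0≤u}} (ι-mono (ℕₚ.<⇒≤ (ℕₚ.≰⇒> m≰))) ⟩
      ι (suc m) *ℚ u                   ≡⟨ mu≡1 ⟩
      1ℚ                               ∎)

-- Flipping blocks

private variable
  n : ℕ
  A : Set

Block : ℕ → Set
Block n = Fin n → Bool

flip : Vec Bool n → Block n → Vec Bool n
flip x B = tabulate (λ v → lookup x v xor B v)

⋃ : List (Block n) → Block n
⋃ Bs v = any (λ B → B v) Bs

Disjoint : Block n → Block n → Set
Disjoint B B′ = ∀ v → B v ≡ true → B′ v ≡ false

xor-false : ∀ b → b xor false ≡ b
xor-false true  = refl
xor-false false = refl

vec-ext : {x y : Vec Bool n} → (∀ v → lookup x v ≡ lookup y v) → x ≡ y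
vec-ext {x = x} {y} e = trans (sym (tabulate∘lookup x)) (trans (tabulate-cong e) (tabulate∘lookup y))

lookup-flip : (x : Vec Bool n) (B : Block n) → ∀ v → lookup (flip x B) v ≡ lookup x v xor B v
lookup-flip x B = lookup∘tabulate (λ v → lookup x v xor B v)

flip-cong : (x : Vec Bool n) {B B′ : Block n} → (∀ v → B v ≡ B′ v) → flip x B ≡ flip x B′
flip-cong x e = tabulate-cong (λ v → cong (lookup x v xor_) (e v))

flip-∅ : (x : Vec Bool n) → flip x (λ _ → false) ≡ x
flip-∅ x = vec-ext (λ v → trans (lookup-flip x _ v) (xor-false (lookup x v)))

lit-cong : ∀ {m} {c c′ : Vec Bool m → Bool} → (∀ y → c y ≡ c′ y) → Lit c′ → Lit c
lit-cong e (fixed b p) = fixed b (λ y → trans (e y) (p y))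
lit-cong e (here b p)  = here b (λ a y → trans (e (a ∷ y)) (p a y))
lit-cong e (there p l) = there (λ a y → trans (e (a ∷ y)) (p a y)) l

-- Substituting literals for the variables does not raise the degree, since the values are idempotent.
deg-subst : ∀ {m} n d {p : Poly n} {σ : Vec Bool m → Vec Bool n} →
  (∀ S → d ≤ count (Boolₚ._≟ true) S → p S ≡ 0ℚ) →
  (∀ v → Lit (λ y → lookup (σ y) v)) → DegBelow d (λ y → evalPoly p (σ y))
deg-subst zero zero {p} {σ} deg lits y with σ y
... | [] = deg [] z≤n
deg-subst zero (suc d) {p} {σ} deg lits = deg-cong (suc d) (λ y → const (σ y)) (deg-const _ d (p []))
  where
  const : ∀ x → evalPoly p x ≡ p []
  const [] = refl
deg-subst (suc n) d {p} {σ} deg lits =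
  deg-cong d (λ y → unfold (σ y)) (deg-+ d (deg-subst n d (λ S → deg (false ∷ S)) lits-tail) (upper d deg))
  where
  unfold : ∀ x → evalPoly p x ≡ evalPoly (λ S → p (false ∷ S)) (tail x) +ℚ
    (if lookup x fzero then evalPoly (λ S → p (true ∷ S)) (tail x) else 0ℚ)
  unfold (b ∷ x) = refl
  lits-tail : ∀ v → Lit (λ y → lookup (tail (σ y)) v)
  lits-tail v = lit-cong (λ y → lookup-tail (σ y)) (lits (fsuc v))
    where
    lookup-tail : ∀ x → lookup (tail x) v ≡ lookup x (fsuc v)
    lookup-tail (b ∷ x) = refl
  upper : ∀ d → (∀ S → d ≤ count (Boolₚ._≟ true) S → p S ≡ 0ℚ) →
    DegBelow d (λ y → if lookup (σ y) fzero then evalPoly (λ S → p (true ∷ S)) (tail (σ y)) else 0ℚ)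
  upper zero deg y with lookup (σ y) fzero
  ... | true  = deg-subst n 0 {λ S → p (true ∷ S)} {λ y → tail (σ y)} (λ S _ → deg (true ∷ S) z≤n) lits-tail y
  ... | false = refl
  -- A monomial containing the first variable has one degree less left for the others, which pays
  -- for the substituted literal.
  upper (suc d) deg = deg-lit d (lits fzero) (deg-subst n d (λ S le → deg (true ∷ S) (s≤s le)) lits-tail)

module _ {A : Set} where

  select : (xs : List A) → Vec Bool (length xs) → List A
  select []       []          = []
  select (x ∷ xs) (true ∷ y)  = x ∷ select xs y
  select (x ∷ xs) (false ∷ y) = select xs y

  select⊆ : ∀ xs y → select xs y ⊆ xs
  select⊆ []       []          = []
  select⊆ (x ∷ xs) (true ∷ y)  = refl ∷ select⊆ xs y
  select⊆ (x ∷ xs) (false ∷ y) = x ∷ʳ select⊆ xs y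

  select-false : ∀ xs → select xs (replicate (length xs) false) ≡ []
  select-false []       = refl
  select-false (x ∷ xs) = select-false xs

  select-nonempty : ∀ xs y → true ∈ y → ∃[ z ] ∃[ zs ] select xs y ≡ z ∷ zs
  select-nonempty (x ∷ xs) (true ∷ y)  _            = x , select xs y , refl
  select-nonempty (x ∷ xs) (false ∷ y) (∈-there t) = select-nonempty xs y t

  AllPairs-resp-⊆ : ∀ {R : A → A → Set} {xs ys} → xs ⊆ ys → AllPairs R ys → AllPairs R xs
  AllPairs-resp-⊆ []         []        = []
  AllPairs-resp-⊆ (y ∷ʳ s)   (_ ∷ ps)  = AllPairs-resp-⊆ s ps
  AllPairs-resp-⊆ (refl ∷ s) (p ∷ ps)  = All-resp-⊆ s p ∷ AllPairs-resp-⊆ s ps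

⋃-select-disjoint : ∀ {Bs : List (Block n)} {v} → All (λ B → B v ≡ false) Bs → ∀ y → ⋃ (select Bs y) v ≡ false
⋃-select-disjoint {Bs = []}     []       []          = refl
⋃-select-disjoint {Bs = B ∷ Bs} (p ∷ ps) (true ∷ y)  = trans (cong (_∨ _) p) (⋃-select-disjoint ps y)
⋃-select-disjoint {Bs = B ∷ Bs} (p ∷ ps) (false ∷ y) = ⋃-select-disjoint ps y

-- At most one of the disjoint blocks contains v, so whether v lies in the chosen union depends on
-- at most one bit of y.
lit-⋃ : (Bs : List (Block n)) → AllPairs Disjoint Bs → ∀ v → Lit (λ y → ⋃ (select Bs y) v)
lit-⋃ []       _          v = fixed false λ { [] → refl }
lit-⋃ (B ∷ Bs) (dis ∷ ps) v with B v in eq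
... | true  = here false λ where
  true  y → cong (_∨ ⋃ (select Bs y) v) eq
  false y → ⋃-select-disjoint (All.map (λ d → d v eq) dis) y
... | false = there (λ where
  true  y → cong (_∨ ⋃ (select Bs y) v) eq
  false y → refl) (lit-⋃ Bs ps v)

lit-flip : (x : Vec Bool n) (Bs : List (Block n)) → AllPairs Disjoint Bs →
  ∀ v → Lit (λ y → lookup (flip x (⋃ (select Bs y))) v)
lit-flip x Bs dis v = lit-cong (λ y → lookup-flip x (⋃ (select Bs y)) v) (lit-xor (lookup x v))
  where
  lit-xor : ∀ b → Lit (λ y → b xor ⋃ (select Bs y) v)
  lit-xor true  = lit-not (lit-⋃ Bs dis v)
  lit-xor false = lit-⋃ Bs dis v

-- Choosing which blocks to flip maps a cube of dimension |Bs| into the domain, each coordinate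
-- being a literal. Pulled back along this map, p keeps degree at most d and x becomes an isolated
-- origin.
independent-blocks : ∀ {d} {p : Poly n} → DegreeAtMost d p → ∀ x Bs → AllPairs Disjoint Bs →
  1ℚ ≤ℚ ∣ evalPoly p x ∣ →
  (∀ B J → B ∷ J ⊆ Bs → ∣ evalPoly p (flip x (⋃ (B ∷ J))) ∣ ≤ℚ ⅓) →
  length Bs ≤ 16 * (d * d)
independent-blocks {n} {d} {p} deg x Bs dis H0 H =
  isolated-point d (deg-subst n (suc d) deg (lit-flip x Bs dis)) (subst (λ z → 1ℚ ≤ℚ ∣ evalPoly p z ∣) (sym base) H0) others
  where
  base : flip x (⋃ (select Bs (replicate (length Bs) false))) ≡ x
  base = trans (cong (λ J → flip x (⋃ J)) (select-false Bs)) (flip-∅ x)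
  others : ∀ y → true ∈ y → ∣ evalPoly p (flip x (⋃ (select Bs y))) ∣ ≤ℚ ⅓
  others y y≠0 with select-nonempty Bs y y≠0
  ... | B , J , eq = subst (λ K → ∣ evalPoly p (flip x (⋃ K)) ∣ ≤ℚ ⅓) (sym eq)
                       (H B J (subst (_⊆ Bs) eq (select⊆ Bs y)))

-- Counting

𝟙 : Bool → ℕ
𝟙 true  = 1
𝟙 false = 0

∑ : List A → (A → ℕ) → ℕ
∑ []       f = 0
∑ (x ∷ xs) f = f x + ∑ xs f

∑-mono : (xs : List A) {f g : A → ℕ} → (∀ {x} → x ∈ˡ xs → f x ≤ g x) → ∑ xs f ≤ ∑ xs g
∑-mono []       H = z≤n
∑-mono (x ∷ xs) H = ℕₚ.+-mono-≤ (H (here refl)) (∑-mono xs (λ y∈ → H (there y∈)))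

∑-mono-< : {xs : List A} {f g : A → ℕ} → (∀ x → f x ≤ g x) → ∀ {x} → x ∈ˡ xs → f x < g x → ∑ xs f < ∑ xs g
∑-mono-< {xs = _ ∷ xs} H (here refl)     lt = ℕₚ.+-mono-<-≤ lt (∑-mono xs (λ {y} _ → H y))
∑-mono-< {xs = y ∷ xs} H (there x∈xs) lt = ℕₚ.+-mono-≤-< (H y) (∑-mono-< H x∈xs lt)

∑-0 : (xs : List A) → ∑ xs (λ _ → 0) ≡ 0
∑-0 []       = refl
∑-0 (x ∷ xs) = ∑-0 xs

∑-+ : (xs : List A) (f g : A → ℕ) → ∑ xs (λ x → f x + g x) ≡ ∑ xs f + ∑ xs g
∑-+ []       f g = refl
∑-+ (x ∷ xs) f g = trans (cong ((f x + g x) +_) (∑-+ xs f g))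
  (interchange ℕₚ.+-commutativeSemigroup (f x) (g x) (∑ xs f) (∑ xs g))

∑-swap : {A B : Set} (xs : List A) (ys : List B) (f : A → B → ℕ) →
  ∑ xs (λ x → ∑ ys (f x)) ≡ ∑ ys (λ y → ∑ xs (λ x → f x y))
∑-swap []       ys f = sym (∑-0 ys)
∑-swap (x ∷ xs) ys f = trans (cong (∑ ys (f x) +_) (∑-swap xs ys f))
  (sym (∑-+ ys (f x) (λ y → ∑ xs (λ x → f x y))))

∑-* : (xs : List A) (c : ℕ) (f : A → ℕ) → ∑ xs (λ x → c * f x) ≡ c * ∑ xs f
∑-* []       c f = sym (ℕₚ.*-zeroʳ c)
∑-* (x ∷ xs) c f = trans (cong ((c * f x) +_) (∑-* xs c f)) (sym (ℕₚ.*-distribˡ-+ c (f x) (∑ xs f)))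

∑-∈ : {xs : List A} (f : A → ℕ) → ∀ {x} → x ∈ˡ xs → f x ≤ ∑ xs f
∑-∈ {xs = x ∷ xs} f (here refl)  = ℕₚ.m≤m+n (f x) (∑ xs f)
∑-∈ {xs = y ∷ xs} f (there x∈xs) = ℕₚ.≤-trans (∑-∈ f x∈xs) (ℕₚ.m≤n+m (∑ xs f) (f y))

𝟙≤ : ∀ b {m} → (b ≡ true → 1 ≤ m) → 𝟙 b ≤ m
𝟙≤ true  H = H refl
𝟙≤ false H = z≤n

∧-true : ∀ {a b} → a ∧ b ≡ true → a ≡ true × b ≡ true
∧-true {true} {true} _ = refl , refl

any-∃ : (p : A → Bool) (xs : List A) → any p xs ≡ true → ∃[ x ] (x ∈ˡ xs × p x ≡ true)
any-∃ p (x ∷ xs) e with p x in eq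
... | true  = x , here refl , eq
... | false with any-∃ p xs e
...   | y , y∈xs , py = y , there y∈xs , py

∃-any : (p : A → Bool) {xs : List A} → ∀ {x} → x ∈ˡ xs → p x ≡ true → any p xs ≡ true
∃-any p {x ∷ xs} (here refl) px = cong (_∨ any p xs) px
∃-any p {y ∷ xs} (there x∈xs) px = trans (cong (p y ∨_) (∃-any p x∈xs px)) (Boolₚ.∨-zeroʳ (p y))

any-false : (p : A → Bool) {xs : List A} → any p xs ≡ false → ∀ {x} → x ∈ˡ xs → p x ≡ false
any-false p e {x} x∈xs with p x in eq
... | false = refl
... | true with trans (sym e) (∃-any p x∈xs eq)
...   | ()

all-true : (p : A → Bool) {xs : List A} → all p xs ≡ true → ∀ {x} → x ∈ˡ xs → p x ≡ true
all-true p e (here refl)     = proj₁ (∧-true e)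
all-true p e (there x∈xs) = all-true p (proj₂ (∧-true {a = p _} e)) x∈xs

all-∃ : (p : A → Bool) (xs : List A) → all p xs ≡ false → ∃[ x ] (x ∈ˡ xs × p x ≡ false)
all-∃ p (x ∷ xs) e with p x in eq
... | false = x , here refl , eq
... | true with all-∃ p xs e
...   | y , y∈xs , py = y , there y∈xs , py

all-intro : (p : A → Bool) (xs : List A) → (∀ {x} → x ∈ˡ xs → p x ≡ true) → all p xs ≡ true
all-intro p []       H = refl
all-intro p (x ∷ xs) H = cong₂ _∧_ (H (here refl)) (all-intro p xs (λ x∈ → H (there x∈)))

all-cong : (p q : A → Bool) {xs : List A} → (∀ {x} → x ∈ˡ xs → p x ≡ q x) → all p xs ≡ all q xs
all-cong p q {[]}     H = refl
all-cong p q {x ∷ xs} H = cong₂ _∧_ (H (here refl)) (all-cong p q (λ m → H (there m)))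

𝟙-any : (p : A → Bool) (xs : List A) → 𝟙 (any p xs) ≤ ∑ xs (λ x → 𝟙 (p x))
𝟙-any p xs = 𝟙≤ (any p xs) λ e → let (x , x∈xs , px) = any-∃ p xs e in
  ℕₚ.≤-trans (ℕₚ.≤-reflexive (cong 𝟙 (sym px))) (∑-∈ (λ x → 𝟙 (p x)) x∈xs)

AllPairs-lookup : ∀ {R : A → A → Set} {xs x y} → AllPairs R xs → x ∈ˡ xs → y ∈ˡ xs → x ≡ y ⊎ (R x y ⊎ R y x)
AllPairs-lookup (_ ∷ ps) (here refl) (here refl) = inj₁ refl
AllPairs-lookup (p ∷ ps) (here refl) (there y∈)  = inj₂ (inj₁ (All.lookup p y∈))
AllPairs-lookup (p ∷ ps) (there x∈)  (here refl) = inj₂ (inj₂ (All.lookup p x∈))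
AllPairs-lookup (_ ∷ ps) (there x∈)  (there y∈)  = AllPairs-lookup ps x∈ y∈

discard : (p : A → Bool) (xs : List A) →
  ∃[ ys ] (ys ⊆ xs × All (λ y → p y ≡ false) ys × length xs ≡ ∑ xs (λ x → 𝟙 (p x)) + length ys)
discard p []       = [] , [] , [] , refl
discard p (x ∷ xs) with p x in eq | discard p xs
... | true  | ys , s , a , e = ys , x ∷ʳ s , a , cong suc e
... | false | ys , s , a , e = x ∷ ys , refl ∷ s , eq ∷ a , trans (cong suc e) (sym (ℕₚ.+-suc _ (length ys)))

-- Keep the head, discard the later elements in conflict with it and repeat: each kept element
-- accounts for at most Δ elements, itself included. The fuel N serves the recursion on a sublist.
greedy : (R : A → A → Bool) (Δ : ℕ) (xs : List A) →
  (∀ y ys → y ∷ ys ⊆ xs → suc (∑ ys (λ z → 𝟙 (R y z))) ≤ Δ) →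
  ∃[ ys ] (ys ⊆ xs × AllPairs (λ y z → R y z ≡ false) ys × length xs ≤ Δ * length ys)
greedy {A} R Δ xs = go (length xs) xs ℕₚ.≤-refl
  where
  go : ∀ N xs → length xs ≤ N → (∀ y ys → y ∷ ys ⊆ xs → suc (∑ ys (λ z → 𝟙 (R y z))) ≤ Δ) →
    ∃[ ys ] (ys ⊆ xs × AllPairs (λ y z → R y z ≡ false) ys × length xs ≤ Δ * length ys)
  go N []       _  H = [] , [] , [] , z≤n
  go (suc N) (x ∷ xs) (s≤s le) H with discard (R x) xs
  ... | ys , s , a , e with go N ys (ℕₚ.≤-trans (ℕₚ.m≤n+m (length ys) _) (ℕₚ.≤-trans (ℕₚ.≤-reflexive (sym e)) le))
                              (λ y zs t → H y zs (x ∷ʳ ⊆-trans t s))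
  ...   | zs , t , ps , bound = x ∷ zs , refl ∷ ⊆-trans t s , All-resp-⊆ t a ∷ ps , (begin
    suc (length xs)                             ≡⟨ cong suc e ⟩
    suc (∑ xs (λ z → 𝟙 (R x z))) + length ys    ≤⟨ ℕₚ.+-mono-≤ (H x xs ⊆-refl) bound ⟩
    Δ + Δ * length zs                           ≡⟨ ℕₚ.*-suc Δ (length zs) ⟨
    Δ * length (x ∷ zs)                         ∎)
    where open ℕₚ.≤-Reasoning

size : Block n → ℕ
size {n} B = ∑ (allFin n) (λ v → 𝟙 (B v))

touches : Block n → Term n → Bool
touches B U = any (λ l → B (proj₁ l)) U

evalLit-flip : (l : Literal n) (x : Vec Bool n) (B : Block n) → evalLit l (flip x B) ≡ evalLit l x xor B (proj₁ l)
evalLit-flip (v , true)  x B = lookup-flip x B v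
evalLit-flip (v , false) x B = trans (cong not (lookup-flip x B v)) (Boolₚ.not-distribˡ-xor (lookup x v) (B v))

evalLit-unflipped : (l : Literal n) (x : Vec Bool n) (B : Block n) → B (proj₁ l) ≡ false → evalLit l (flip x B) ≡ evalLit l x
evalLit-unflipped l x B e = trans (evalLit-flip l x B) (trans (cong (evalLit l x xor_) e) (xor-false _))

untouched : (U : Term n) (x : Vec Bool n) (B : Block n) → touches B U ≡ false → evalTerm U (flip x B) ≡ evalTerm U x
untouched U x B e = all-cong _ _ {U}
  (λ {l} l∈U → evalLit-unflipped l x B (any-false (λ l → B (proj₁ l)) {U} e l∈U))

occurs-self : ∀ {l : Literal n} {U} → l ∈ˡ U → occursIn (proj₁ l) U ≡ true
occurs-self {l = v , b} l∈U = ∃-any (λ l → ⌊ proj₁ l ≟ᶠ v ⌋) l∈U (same v)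
  where
  same : ∀ v → ⌊ v ≟ᶠ v ⌋ ≡ true
  same v with v ≟ᶠ v
  ... | yes _   = refl
  ... | no  v≢v = ⊥-elim (v≢v refl)

filter-∑ : (p : A → Bool) (xs : List A) → length (filter (λ t → p t Boolₚ.≟ true) xs) ≡ ∑ xs (λ t → 𝟙 (p t))
filter-∑ p []       = refl
filter-∑ p (x ∷ xs) with p x
... | true  = cong suc (filter-∑ p xs)
... | false = filter-∑ p xs

-- Double counting: a touched term contains a variable of B, and each variable occurs in at most k
-- terms.
touching-terms : ∀ {k} (φ : DNF n) → ReadK k φ → (B : Block n) → ∑ φ (λ U → 𝟙 (touches B U)) ≤ k * size B
touching-terms {n} {k} φ rk B = begin
  ∑ φ (λ U → 𝟙 (touches B U))                                          ≤⟨ ∑-mono φ (λ {U} _ → some U) ⟩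
  ∑ φ (λ U → ∑ (allFin n) (λ v → 𝟙 (B v) * 𝟙 (occursIn v U)))          ≡⟨ ∑-swap φ (allFin n) (λ U v → 𝟙 (B v) * 𝟙 (occursIn v U)) ⟩
  ∑ (allFin n) (λ v → ∑ φ (λ U → 𝟙 (B v) * 𝟙 (occursIn v U)))          ≤⟨ ∑-mono (allFin n) (λ {v} _ → few v) ⟩
  ∑ (allFin n) (λ v → k * 𝟙 (B v))                                     ≡⟨ ∑-* (allFin n) k (λ v → 𝟙 (B v)) ⟩
  k * size B                                                           ∎
  where
  open ℕₚ.≤-Reasoning
  some : ∀ U → 𝟙 (touches B U) ≤ ∑ (allFin n) (λ v → 𝟙 (B v) * 𝟙 (occursIn v U))
  some U = 𝟙≤ (touches B U) λ e → let (l , l∈U , Bl) = any-∃ (λ l → B (proj₁ l)) U e in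
    ℕₚ.≤-trans (ℕₚ.≤-reflexive (sym (cong₂ (λ a b → 𝟙 a * 𝟙 b) Bl (occurs-self l∈U))))
      (∑-∈ (λ v → 𝟙 (B v) * 𝟙 (occursIn v U)) (∈-allFin (proj₁ l)))
  few : ∀ v → ∑ φ (λ U → 𝟙 (B v) * 𝟙 (occursIn v U)) ≤ k * 𝟙 (B v)
  few v = begin
    ∑ φ (λ U → 𝟙 (B v) * 𝟙 (occursIn v U))   ≡⟨ ∑-* φ (𝟙 (B v)) (λ U → 𝟙 (occursIn v U)) ⟩
    𝟙 (B v) * ∑ φ (λ U → 𝟙 (occursIn v U))   ≡⟨ ℕₚ.*-comm (𝟙 (B v)) _ ⟩
    ∑ φ (λ U → 𝟙 (occursIn v U)) * 𝟙 (B v)   ≤⟨ ℕₚ.*-monoˡ-≤ (𝟙 (B v)) (ℕₚ.≤-trans (ℕₚ.≤-reflexive (sym (filter-∑ (occursIn v) φ))) (rk v)) ⟩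
    k * 𝟙 (B v)                              ∎

disjoint-at : ∀ {Bs : List (Block n)} → AllPairs Disjoint Bs → ∀ v → ∑ Bs (λ B → 𝟙 (B v)) ≤ 1
disjoint-at []         v = z≤n
disjoint-at {Bs = B ∷ Bs} (d ∷ ps) v with B v in eq
... | false = disjoint-at ps v
... | true  = ℕₚ.≤-reflexive (cong suc (none d))
  where
  none : ∀ {Bs} → All (Disjoint B) Bs → ∑ Bs (λ B → 𝟙 (B v)) ≡ 0
  none []       = refl
  none (d ∷ ds) = cong₂ _+_ (cong 𝟙 (d v eq)) (none ds)

-- Each conflicting block is charged to a term through which it conflicts, and no term is charged by
-- two blocks.
conflicts : {A B : Set} (φ : List A) (C : A → Bool) (K : A → B → Bool) (Bs : List B) →
  (∀ U → U ∈ˡ φ → ∑ Bs (λ B → 𝟙 (K U B)) ≤ 1) →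
  ∑ Bs (λ B → 𝟙 (any (λ U → C U ∧ K U B) φ)) ≤ ∑ φ (λ U → 𝟙 (C U))
conflicts φ C K Bs H = begin
  ∑ Bs (λ B → 𝟙 (any (λ U → C U ∧ K U B) φ))       ≤⟨ ∑-mono Bs (λ {B} _ → 𝟙-any (λ U → C U ∧ K U B) φ) ⟩
  ∑ Bs (λ B → ∑ φ (λ U → 𝟙 (C U ∧ K U B)))         ≡⟨ ∑-swap Bs φ (λ B U → 𝟙 (C U ∧ K U B)) ⟩
  ∑ φ (λ U → ∑ Bs (λ B → 𝟙 (C U ∧ K U B)))         ≤⟨ ∑-mono φ (λ {U} U∈φ → one U U∈φ) ⟩
  ∑ φ (λ U → 𝟙 (C U))                              ∎
  where
  open ℕₚ.≤-Reasoning
  one : ∀ U → U ∈ˡ φ → ∑ Bs (λ B → 𝟙 (C U ∧ K U B)) ≤ 𝟙 (C U)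
  one U U∈φ with C U
  ... | true  = H U U∈φ
  ... | false = ℕₚ.≤-reflexive (∑-0 Bs)

-- Disjoint sensitive blocks of a read-k DNF

false≢true : ∀ {b} {A : Set} → b ≡ false → b ≡ true → A
false≢true refl ()

-- The polynomials for f and for its complement are indexed by the value c on which they are large,
-- so that 1-inputs and 0-inputs can share arguments.
module Sensitivity {n k} (φ : DNF n) (f : BoolFun n) (comp : Computes φ f) (rk : ReadK k φ) (deg : Bool → ℕ)
  (witness : ∀ c → ∃[ p ] (DegreeAtMost (deg c) p × (∀ x →
    (f x ≡ c → 1ℚ ≤ℚ ∣ evalPoly p x ∣) × (f x ≡ not c → ∣ evalPoly p x ∣ ≤ℚ ⅓)))) where

  L : Bool → ℕ
  L c = 16 * (deg c * deg c)

  term-true : ∀ {U x} → U ∈ˡ φ → evalTerm U x ≡ true → f x ≡ true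
  term-true {x = x} U∈φ e = trans (sym (comp x)) (∃-any (λ U → evalTerm U x) U∈φ e)

  true-term : ∀ {x} → f x ≡ true → ∃[ U ] (U ∈ˡ φ × evalTerm U x ≡ true)
  true-term {x} e = any-∃ (λ U → evalTerm U x) φ (trans (comp x) e)

  term-false : ∀ {U x} → f x ≡ false → U ∈ˡ φ → evalTerm U x ≡ false
  term-false {x = x} e U∈φ = any-false (λ U → evalTerm U x) (trans (comp x) e) U∈φ

  independent-bound : ∀ x Bs → AllPairs Disjoint Bs →
    (∀ B J → B ∷ J ⊆ Bs → f (flip x (⋃ (B ∷ J))) ≡ not (f x)) → length Bs ≤ L (f x)
  independent-bound x Bs dis H with witness (f x)
  ... | p , degp , sep = independent-blocks degp x Bs dis (proj₁ (sep x) refl)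
    (λ B J s → proj₂ (sep (flip x (⋃ (B ∷ J)))) (H B J s))

  falsified-flipped : ∀ (l : Literal n) x B → evalLit l x ≡ false → evalLit l (flip x B) ≡ true → B (proj₁ l) ≡ true
  falsified-flipped l x B e e′ = trans (sym (cong (_xor B (proj₁ l)) e)) (trans (sym (evalLit-flip l x B)) e′)

  module Zero (x : Vec Bool n) (fx : f x ≡ false) where

    -- B conflicts with B′ through a term that B′ makes true and that B touches: flipping B as well
    -- could falsify it again.
    R : Block n → Block n → Bool
    R B B′ = any (λ U → touches B U ∧ evalTerm U (flip x B′)) φ

    touched : ∀ {B U} → U ∈ˡ φ → evalTerm U (flip x B) ≡ true → touches B U ≡ true
    touched {B} {U} U∈φ e with touches B U in eq
    ... | true  = refl
    ... | false = false≢true (trans (untouched U x B eq) (term-false fx U∈φ)) e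

    R-refl : ∀ {B} → f (flip x B) ≡ true → R B B ≡ true
    R-refl {B} e with true-term e
    ... | U , U∈φ , e′ = ∃-any (λ U → touches B U ∧ evalTerm U (flip x B)) U∈φ (cong₂ _∧_ (touched {B} U∈φ e′) e′)

    -- Each term has a literal that is false at x, and a block making the term true must contain its
    -- variable; by disjointness at most one block does. The successor counts B itself, which
    -- conflicts with itself by `R-refl`.
    sparse : ∀ {s B Bs} → AllPairs Disjoint (B ∷ Bs) → f (flip x B) ≡ true → size B ≤ s →
      suc (∑ Bs (λ B′ → 𝟙 (R B B′))) ≤ k * s
    sparse {s} {B} {Bs} dis e le = begin
      suc (∑ Bs (λ B′ → 𝟙 (R B B′)))         ≡⟨ cong (λ b → 𝟙 b + ∑ Bs (λ B′ → 𝟙 (R B B′))) (R-refl e) ⟨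
      ∑ (B ∷ Bs) (λ B′ → 𝟙 (R B B′))         ≤⟨ conflicts φ (touches B) (λ U B′ → evalTerm U (flip x B′)) (B ∷ Bs) one ⟩
      ∑ φ (λ U → 𝟙 (touches B U))            ≤⟨ touching-terms φ rk B ⟩
      k * size B                             ≤⟨ ℕₚ.*-monoʳ-≤ k le ⟩
      k * s                                  ∎
      where
      open ℕₚ.≤-Reasoning
      one : ∀ U → U ∈ˡ φ → ∑ (B ∷ Bs) (λ B′ → 𝟙 (evalTerm U (flip x B′))) ≤ 1
      one U U∈φ with all-∃ (λ l → evalLit l x) U (term-false fx U∈φ)
      ... | l , l∈U , lx = ℕₚ.≤-trans
        (∑-mono (B ∷ Bs) (λ {B′} _ → 𝟙≤ (evalTerm U (flip x B′)) (λ e → ℕₚ.≤-reflexive (cong 𝟙 (sym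
          (falsified-flipped l x B′ lx (all-true (λ l → evalLit l (flip x B′)) e l∈U)))))))
        (disjoint-at dis (proj₁ l))

    -- A term made true by the last block is not touched by the earlier ones.
    union-true : ∀ B J → AllPairs (λ B B′ → R B B′ ≡ false) (B ∷ J) → All (λ B → f (flip x B) ≡ true) (B ∷ J) →
      ∃[ U ] ∃[ B′ ] (U ∈ˡ φ × B′ ∈ˡ (B ∷ J) × evalTerm U (flip x B′) ≡ true × evalTerm U (flip x (⋃ (B ∷ J))) ≡ true)
    union-true B [] _ (e ∷ []) with true-term e
    ... | U , U∈φ , e′ = U , B , U∈φ , here refl , e′ ,
      trans (cong (evalTerm U) (flip-cong x (λ v → Boolₚ.∨-identityʳ (B v)))) e′
    union-true B (B₂ ∷ J) (r ∷ rs) (_ ∷ es) with union-true B₂ J rs es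
    ... | U , B′ , U∈φ , B′∈ , e , e′ = U , B′ , U∈φ , there B′∈ , e , trans (all-cong _ _ {U} same) e′
      where
      not-touched : touches B U ≡ false
      not-touched with touches B U in eq
      ... | false = refl
      ... | true  = false≢true (any-false (λ U → touches B U ∧ evalTerm U (flip x B′)) (All.lookup r B′∈) U∈φ)
                      (cong₂ _∧_ eq e)
      same : ∀ {l} → l ∈ˡ U → evalLit l (flip x (⋃ (B ∷ B₂ ∷ J))) ≡ evalLit l (flip x (⋃ (B₂ ∷ J)))
      same {l} l∈U = trans (evalLit-flip l x (⋃ (B ∷ B₂ ∷ J))) (trans
        (cong (λ b → evalLit l x xor (b ∨ ⋃ (B₂ ∷ J) (proj₁ l))) (any-false (λ l → B (proj₁ l)) {U} not-touched l∈U))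
        (sym (evalLit-flip l x (⋃ (B₂ ∷ J)))))

  module One (x : Vec Bool n) (fx : f x ≡ true) where

    meets : Block n → Term n → Bool
    meets B U = any (λ l → not (evalLit l x) ∧ B (proj₁ l)) U

    -- Only the first false literal of U outside B is charged, so that in a disjoint family
    -- each U contributes at most one conflict of B.
    escapes : Block n → Term n → Block n → Bool
    escapes B []      B′ = false
    escapes B (l ∷ U) B′ = if not (evalLit l x) ∧ not (B (proj₁ l)) then B′ (proj₁ l) else escapes B U B′

    -- The danger is a term U that several blocks make true only jointly: B corrects some false
    -- literal of U, and B′ the first one that B leaves false.
    R : Block n → Block n → Bool
    R B B′ = any (λ U → meets B U ∧ escapes B U B′) φ

    -- A term T true at x must be touched by B, since B makes f false, but it has no false literal
    -- for B to meet. So strictly fewer terms are met than touched, which makes room for the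
    -- successor.
    sparse : ∀ {s B Bs} → AllPairs Disjoint (B ∷ Bs) → f (flip x B) ≡ false → size B ≤ s →
      suc (∑ Bs (λ B′ → 𝟙 (R B B′))) ≤ k * s
    sparse {s} {B} {Bs} (_ ∷ dis) e le with true-term fx
    ... | T , T∈φ , Tx = begin
      suc (∑ Bs (λ B′ → 𝟙 (R B B′)))         ≤⟨ s≤s (conflicts φ (meets B) (escapes B) Bs (λ U _ → one U)) ⟩
      suc (∑ φ (λ U → 𝟙 (meets B U)))        ≤⟨ ∑-mono-< meets≤touches T∈φ missed ⟩
      ∑ φ (λ U → 𝟙 (touches B U))            ≤⟨ touching-terms φ rk B ⟩
      k * size B                             ≤⟨ ℕₚ.*-monoʳ-≤ k le ⟩
      k * s                                  ∎
      where
      open ℕₚ.≤-Reasoning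
      one : ∀ U → ∑ Bs (λ B′ → 𝟙 (escapes B U B′)) ≤ 1
      one []      = ℕₚ.≤-trans (ℕₚ.≤-reflexive (∑-0 Bs)) z≤n
      one (l ∷ U) with not (evalLit l x) ∧ not (B (proj₁ l))
      ... | true  = disjoint-at dis (proj₁ l)
      ... | false = one U
      meets≤touches : ∀ U → 𝟙 (meets B U) ≤ 𝟙 (touches B U)
      meets≤touches U = 𝟙≤ (meets B U) λ m → let (l , l∈U , e) = any-∃ _ U m in
        ℕₚ.≤-reflexive (cong 𝟙 (sym (∃-any (λ l → B (proj₁ l)) l∈U (proj₂ (∧-true {not (evalLit l x)} e)))))
      missed : 𝟙 (meets B T) < 𝟙 (touches B T)
      missed with meets B T in m | touches B T in t
      ... | false | true  = s≤s z≤n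
      ... | _     | false = false≢true (trans (sym (untouched T x B t)) (term-false e T∈φ)) Tx
      ... | true  | true  = let (l , l∈T , e) = any-∃ _ T m in
        false≢true (cong not (all-true (λ l → evalLit l x) Tx l∈T)) (proj₁ (∧-true e))

    -- With the empty block, B₁ holds the very first false literal of U. By disjointness this
    -- literal is outside B, so it is also the first false one outside B.
    escapes-∅ : ∀ U {B B₁} → Disjoint B B₁ → escapes (λ _ → false) U B₁ ≡ true → escapes B U B₁ ≡ true
    escapes-∅ (l ∷ U) {B} {B₁} dis e with evalLit l x
    ... | true  = escapes-∅ U dis e
    ... | false with B (proj₁ l) in eq
    ...   | false = e
    ...   | true  = false≢true (dis (proj₁ l) eq) e

    -- The first false literal outside B, if there is one, lies in some member of Bs, because the
    -- union covers all false literals.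
    escape : ∀ U Bs B → (∀ {l} → l ∈ˡ U → evalLit l x ≡ false → ⋃ Bs (proj₁ l) ≡ true) →
      (∀ {l} → l ∈ˡ U → evalLit l x ≡ false → B (proj₁ l) ≡ true) ⊎
      ∃[ B′ ] (B′ ∈ˡ Bs × escapes B U B′ ≡ true ×
        ∃[ l ] (l ∈ˡ U × evalLit l x ≡ false × B (proj₁ l) ≡ false × B′ (proj₁ l) ≡ true))
    escape [] Bs B H = inj₁ λ ()
    escape (l ∷ U) Bs B H with evalLit l x in lx | B (proj₁ l) in Bl
    ... | false | false = let (B′ , B′∈ , e) = any-∃ (λ B → B (proj₁ l)) Bs (H (here refl) lx) in
      inj₂ (B′ , B′∈ , e , l , here refl , lx , Bl , e)
    ... | false | true with escape U Bs B (λ l∈ → H (there l∈))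
    ...   | inj₁ a = inj₁ λ { (here refl) _ → Bl ; (there l∈) → a l∈ }
    ...   | inj₂ (B′ , B′∈ , e , m , m∈ , p) = inj₂ (B′ , B′∈ , e , m , there m∈ , p)
    escape (l ∷ U) Bs B H | true | _ with escape U Bs B (λ l∈ → H (there l∈))
    ...   | inj₁ a = inj₁ λ { (here refl) e → false≢true e lx ; (there l∈) → a l∈ }
    ...   | inj₂ (B′ , B′∈ , e , m , m∈ , p) = inj₂ (B′ , B′∈ , e , m , there m∈ , p)

    -- Suppose the union makes U true. Let B₁ hold the first false literal of U and B₂ the first one
    -- outside B₁. Whichever of the two comes first in the list conflicts with the other. If B₂ does
    -- not exist, B₁ alone makes U true, although f is false after flipping B₁.
    union-false : ∀ B J → AllPairs Disjoint (B ∷ J) → AllPairs (λ B B′ → R B B′ ≡ false) (B ∷ J) →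
      All (λ B → f (flip x B) ≡ false) (B ∷ J) → f (flip x (⋃ (B ∷ J))) ≡ false
    union-false B J dis indep es with f (flip x (⋃ (B ∷ J))) in fz
    ... | false = refl
    ... | true with true-term fz
    ...   | U , U∈φ , Uz = case escape U (B ∷ J) (λ _ → false) inside of λ where
        -- U has no false literal at x, so any single block of the family leaves it true.
        (inj₁ none) → stuck (here refl) (λ l∈ e → false≢true refl (none l∈ e))
        (inj₂ (B₁ , B₁∈ , e₁ , l₁ , l₁∈ , x₁ , _ , in₁)) → case escape U (B ∷ J) B₁ inside of λ where
          (inj₁ a) → stuck B₁∈ a
          (inj₂ (B₂ , B₂∈ , e₂ , l₂ , l₂∈ , x₂ , out₂ , in₂)) →
            case AllPairs-lookup (AllPairs.zip (dis , indep)) B₁∈ B₂∈ of λ where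
              (inj₁ refl)             → false≢true out₂ in₂
              (inj₂ (inj₁ (_ , r)))   → conflict r l₁∈ x₁ in₁ e₂
              -- B₂ comes first here; B₁ holds the first false literal of U, which is outside B₂.
              (inj₂ (inj₂ (d , r)))   → conflict r l₂∈ x₂ in₂ (escapes-∅ U d e₁)
      where
      inside : ∀ {l} → l ∈ˡ U → evalLit l x ≡ false → ⋃ (B ∷ J) (proj₁ l) ≡ true
      inside {l} l∈ e = falsified-flipped l x (⋃ (B ∷ J)) e (all-true (λ l → evalLit l (flip x (⋃ (B ∷ J)))) Uz l∈)
      conflict : ∀ {B₁ B₂ l} {A : Set} → R B₁ B₂ ≡ false → l ∈ˡ U → evalLit l x ≡ false → B₁ (proj₁ l) ≡ true →
        escapes B₁ U B₂ ≡ true → A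
      conflict {B₁} {B₂} r l∈ lx in₁ e = false≢true r (∃-any (λ U → meets B₁ U ∧ escapes B₁ U B₂) U∈φ
        (cong₂ _∧_ (∃-any (λ l → not (evalLit l x) ∧ B₁ (proj₁ l)) l∈ (cong₂ _∧_ (cong not lx) in₁)) e))
      stuck : ∀ {B₁} {A : Set} → B₁ ∈ˡ (B ∷ J) → (∀ {l} → l ∈ˡ U → evalLit l x ≡ false → B₁ (proj₁ l) ≡ true) → A
      stuck {B₁} B₁∈ a = false≢true (All.lookup es B₁∈) (term-true U∈φ (all-intro (λ l → evalLit l (flip x B₁)) U lit))
        where
        lit : ∀ {l} → l ∈ˡ U → evalLit l (flip x B₁) ≡ true
        lit {l} l∈ with B₁ (proj₁ l) in eq
        ... | true = trans (evalLit-flip l x B₁) (trans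
          (cong (evalLit l x xor_) (trans eq (sym (∃-any (λ B → B (proj₁ l)) B₁∈ eq))))
          (trans (sym (evalLit-flip l x (⋃ (B ∷ J)))) (all-true (λ l → evalLit l (flip x (⋃ (B ∷ J)))) Uz l∈)))
        ... | false with evalLit l x in lx
        ...   | true  = trans (evalLit-unflipped l x B₁ eq) lx
        ...   | false = false≢true eq (a l∈ lx)

  -- A greedy choice keeps a 1/(ks) fraction of the blocks, among which no conflict R remains.
  family-bound : ∀ x s Bs → AllPairs Disjoint Bs → All (λ B → f (flip x B) ≡ not (f x) × size B ≤ s) Bs →
    length Bs ≤ k * s * L (f x)
  family-bound x s Bs dis good = case f x Boolₚ.≟ false of λ where
      (yes fx) → conclude fx (Zero.R x fx) (Zero.sparse x fx) λ B J _ indep es →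
        let (_ , _ , U∈φ , _ , _ , e) = Zero.union-true x fx B J indep es in term-true U∈φ e
      (no fx≢) → let fx = Boolₚ.¬-not fx≢ in conclude fx (One.R x fx) (One.sparse x fx) (One.union-false x fx)
    where
    conclude : ∀ {c} → f x ≡ c → (R : Block n → Block n → Bool) →
      (∀ {s B Cs} → AllPairs Disjoint (B ∷ Cs) → f (flip x B) ≡ not c → size B ≤ s → suc (∑ Cs (λ C → 𝟙 (R B C))) ≤ k * s) →
      (∀ B J → AllPairs Disjoint (B ∷ J) → AllPairs (λ B C → R B C ≡ false) (B ∷ J) →
        All (λ B → f (flip x B) ≡ not c) (B ∷ J) → f (flip x (⋃ (B ∷ J))) ≡ not c) →
      length Bs ≤ k * s * L (f x)
    conclude refl R sparse union with greedy R (k * s) Bs (λ B Cs sub →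
      let (e , le) = All.head (All-resp-⊆ sub good) in sparse (AllPairs-resp-⊆ sub dis) e le)
    ... | I , I⊆ , indep , bound = ℕₚ.≤-trans bound (ℕₚ.*-monoʳ-≤ (k * s)
      (independent-bound x I (AllPairs-resp-⊆ I⊆ dis) λ B J sub →
        union B J (AllPairs-resp-⊆ (⊆-trans sub I⊆) dis) (AllPairs-resp-⊆ sub indep)
          (All.map proj₁ (All-resp-⊆ (⊆-trans sub I⊆) good))))

-- Certificates and exact degree

single : Fin n → Block n
single v w = ⌊ v ≟ᶠ w ⌋

single-≡ : ∀ {v w : Fin n} → single v w ≡ true → v ≡ w
single-≡ {v = v} {w} e with v ≟ᶠ w
... | yes v≡w = v≡w

elements : Block n → List (Fin n)
elements {n} B = filter (λ v → B v Boolₚ.≟ true) (allFin n)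

length-elements : (B : Block n) → length (elements B) ≡ size B
length-elements {n} B = filter-∑ B (allFin n)

∈-elements : ∀ {B : Block n} {v} → B v ≡ true → v ∈ˡ elements B
∈-elements {B = B} {v} = ∈-filter⁺ (λ v → B v Boolₚ.≟ true) (∈-allFin v)

singles-disjoint : (B : Block n) → AllPairs Disjoint (map single (elements B))
singles-disjoint {n} B = AllPairsₚ.map⁺ (AllPairs.map distinct
  (AllPairsₚ.filter⁺ (λ v → B v Boolₚ.≟ true) (allFin⁺ n)))
  where
  distinct : ∀ {v w : Fin n} → v ≢ w → Disjoint (single v) (single w)
  distinct {v} {w} v≢w u e with w ≟ᶠ u
  ... | no  _   = refl
  ... | yes w≡u = ⊥-elim (v≢w (trans (single-≡ e) (sym w≡u)))

size-single : (v : Fin n) → size (single v) ≤ 1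
size-single {n} v = go (allFin n) (allFin⁺ n)
  where
  none : ∀ {xs} → All (v ≢_) xs → ∑ xs (λ w → 𝟙 (single v w)) ≡ 0
  none []        = refl
  none {x ∷ _} (v≢x ∷ ps) with v ≟ᶠ x
  ... | yes v≡x = ⊥-elim (v≢x v≡x)
  ... | no  _   = none ps
  go : ∀ xs → AllPairs _≢_ xs → ∑ xs (λ w → 𝟙 (single v w)) ≤ 1
  go []       _        = z≤n
  go (x ∷ xs) (p ∷ ps) with v ≟ᶠ x
  ... | yes refl = ℕₚ.≤-reflexive (cong suc (none p))
  ... | no  _    = go xs ps

_∖_ : Block n → Fin n → Block n
(B ∖ v) w = B w ∧ not (single v w)

∖-self : ∀ (B : Block n) v → (B ∖ v) v ≡ false
∖-self B v with v ≟ᶠ v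
... | yes _   = Boolₚ.∧-zeroʳ (B v)
... | no  v≢v = ⊥-elim (v≢v refl)

flip-flip-single : ∀ (x : Vec Bool n) (B : Block n) {v} → B v ≡ true → flip (flip x B) (single v) ≡ flip x (B ∖ v)
flip-flip-single x B {v} Bv = vec-ext λ w → trans (lookup-flip (flip x B) (single v) w)
  (trans (cong (_xor single v w) (lookup-flip x B w)) (trans (cancel w) (sym (lookup-flip x (B ∖ v) w))))
  where
  cancel : ∀ w → (lookup x w xor B w) xor single v w ≡ lookup x w xor (B w ∧ not (single v w))
  cancel w with v ≟ᶠ w
  ... | no _ = trans (xor-false _) (cong (lookup x w xor_) (sym (Boolₚ.∧-identityʳ (B w))))
  ... | yes refl rewrite Bv with lookup x w
  ...   | true  = refl
  ...   | false = refl

diff : Vec Bool n → Vec Bool n → Block n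
diff x y v = lookup x v xor lookup y v

flip-diff : (x y : Vec Bool n) → flip x (diff x y) ≡ y
flip-diff x y = vec-ext λ v → trans (lookup-flip x (diff x y) v) (cancel (lookup x v) (lookup y v))
  where
  cancel : ∀ a b → a xor (a xor b) ≡ b
  cancel true  true  = refl
  cancel true  false = refl
  cancel false b     = refl

diff-≡ : (x y : Vec Bool n) → ∀ {v} → lookup x v ≡ lookup y v → diff x y v ≡ false
diff-≡ x y {v} e rewrite e with lookup y v
... | true  = refl
... | false = refl

search : ∀ n {P : Vec Bool n → Set} → (∀ x → Dec (P x)) → Dec (∃[ x ] P x)
search zero P? with P? []
... | yes p = yes ([] , p)
... | no ¬p = no λ { ([] , p) → ¬p p }
search (suc n) P? with search n (λ x → P? (false ∷ x)) | search n (λ x → P? (true ∷ x))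
... | yes (x , p) | _           = yes (false ∷ x , p)
... | no _        | yes (x , p) = yes (true ∷ x , p)
... | no ¬p       | no ¬q       = no λ { (false ∷ x , p) → ¬p (x , p) ; (true ∷ x , q) → ¬q (x , q) }

≢not : ∀ {a b} → a ≢ not b → a ≡ b
≢not {a} {b} ne = trans (Boolₚ.¬-not ne) (Boolₚ.not-involutive b)

deg-≤ : ∀ {m d e} {g : Vec Bool m → ℚ} → d ≤ e → DegBelow d g → DegBelow e g
deg-≤ {d = d} {e} {g} le p = subst (λ e → DegBelow e g) (ℕₚ.m∸n+n≡m le) (go (e ∸ d))
  where
  go : ∀ j → DegBelow (j + d) g
  go zero    = p
  go (suc j) = deg-suc (j + d) (go j)

-- From here on the DNF enters only through `family-bound`.
module Certificates {n} (f : BoolFun n) (k : ℕ) (L : Bool → ℕ)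
  (family-bound : ∀ x s Bs → AllPairs Disjoint Bs → All (λ B → f (flip x B) ≡ not (f x) × size B ≤ s) Bs →
    length Bs ≤ k * s * L (f x)) where

  open DecMembership (_≟ᶠ_ {n}) using (_∈?_)

  Tight : Vec Bool n → Block n → Set
  Tight x B = f (flip x B) ≡ not (f x) × (∀ v → B v ≡ true → f (flip x (B ∖ v)) ≡ f x)

  -- Bounds the size of tight blocks at points of value c. The value is negated because singletons,
  -- with s = 1, are counted at the flipped point.
  width : Bool → ℕ
  width c = k * 1 * L (not c)

  -- The resulting bound on block sensitivity at points of value c.
  bs : Bool → ℕ
  bs c = k * width c * L c

  -- After B has been flipped, undoing any one of its variables restores the value, so the
  -- singletons of B are disjoint sensitive blocks there.
  tight-size : ∀ {x B} → Tight x B → size B ≤ width (f x)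
  tight-size {x} {B} (e , tight) = begin
    size B                               ≡⟨ trans (length-map single (elements B)) (length-elements B) ⟨
    length (map single (elements B))     ≤⟨ family-bound (flip x B) 1 _ (singles-disjoint B) (Allₚ.map⁺ (All.tabulate sens)) ⟩
    k * 1 * L (f (flip x B))             ≡⟨ cong (λ c → k * 1 * L c) e ⟩
    width (f x)                          ∎
    where
    open ℕₚ.≤-Reasoning
    sens : ∀ {v} → v ∈ˡ elements B → f (flip (flip x B) (single v)) ≡ not (f (flip x B)) × size (single v) ≤ 1
    sens {v} v∈ = let Bv = proj₂ (∈-filter⁻ (λ v → B v Boolₚ.≟ true) {xs = allFin n} v∈) in
      trans (cong f (flip-flip-single x B Bv)) (trans (tight v Bv) (trans (sym (Boolₚ.not-involutive (f x))) (cong not (sym e)))) ,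
      size-single v

  -- Variables are dropped one at a time while the block stays sensitive; the size decreases at each
  -- step.
  shrink : ∀ x B → f (flip x B) ≡ not (f x) → ∃[ C ] ((∀ v → C v ≡ true → B v ≡ true) × Tight x C)
  shrink x B = go (size B) B ℕₚ.≤-refl
    where
    go : ∀ N B → size B ≤ N → f (flip x B) ≡ not (f x) → ∃[ C ] ((∀ v → C v ≡ true → B v ≡ true) × Tight x C)
    go N B le e with Finₚ.any? (λ v → (B v Boolₚ.≟ true) ×-dec (f (flip x (B ∖ v)) Boolₚ.≟ not (f x)))
    ... | no none = B , (λ _ p → p) , e , λ v Bv → ≢not (λ q → none (v , Bv , q))
    ... | yes (v , Bv , e′) = descend N le
      where
      𝟙-∧ : ∀ a {b} → 𝟙 (a ∧ b) ≤ 𝟙 a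
      𝟙-∧ a {b} = 𝟙≤ (a ∧ b) λ p → ℕₚ.≤-reflexive (cong 𝟙 (sym (proj₁ (∧-true p))))
      smaller : size (B ∖ v) < size B
      smaller = ∑-mono-< (λ w → 𝟙-∧ (B w)) (∈-allFin v)
        (ℕₚ.≤-reflexive (trans (cong suc (cong 𝟙 (∖-self B v))) (cong 𝟙 (sym Bv))))
      descend : ∀ N → size B ≤ N → ∃[ C ] ((∀ v → C v ≡ true → B v ≡ true) × Tight x C)
      descend zero    le = ⊥-elim (ℕₚ.<⇒≱ (ℕₚ.<-≤-trans smaller le) z≤n)
      descend (suc N) le with go N (B ∖ v) (ℕₚ.≤-pred (ℕₚ.<-≤-trans smaller le)) e′
      ... | C , C⊆ , tight = C , (λ w Cw → proj₁ (∧-true (C⊆ w Cw))) , tight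

  separate : ∀ x y → f y ≡ not (f x) → ∃[ C ] ((∀ v → C v ≡ true → diff x y v ≡ true) × Tight x C)
  separate x y e = shrink x (diff x y) (trans (cong f (flip-diff x y)) e)

  TightFamily : Vec Bool n → List (Block n) → Set
  TightFamily x Bs = AllPairs Disjoint Bs × All (Tight x) Bs

  tight-family-bound : ∀ {x Bs} → TightFamily x Bs → length Bs ≤ bs (f x)
  tight-family-bound {x} {Bs} (dis , ts) = family-bound x (width (f x)) Bs dis (All.map (λ t → proj₁ t , tight-size t) ts)

  extend : ∀ {x B Bs} → TightFamily x Bs → Tight x B →
    (∀ {B′ v} → B′ ∈ˡ Bs → B v ≡ true → B′ v ≡ false) → TightFamily x (B ∷ Bs)
  extend (dis , ts) t d = (All.tabulate (λ B′∈ v → d B′∈) ∷ dis) , (t ∷ ts)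

  Agree : List (Fin n) → Vec Bool n → Vec Bool n → Set
  Agree Q x y = All (λ v → lookup y v ≡ lookup x v) Q

  -- Take the variables of a growing disjoint family of tight blocks. A point y that agrees with x
  -- on them but has the other value yields a further disjoint tight block, and this can happen at
  -- most `bs (f x)` times.
  certificate : ∀ x → ∃[ Q ] (length Q ≤ bs (f x) * width (f x) × (∀ y → Agree Q x y → f y ≡ f x))
  certificate x = go (bs (f x)) [] ([] , []) (ℕₚ.m≤m+n (bs (f x)) 0)
    where
    length-concat : ∀ {Bs} → All (Tight x) Bs → length (concatMap elements Bs) ≤ length Bs * width (f x)
    length-concat [] = z≤n
    length-concat {B ∷ Bs} (t ∷ ts) = ℕₚ.≤-trans (ℕₚ.≤-reflexive (length-++ (elements B)))
      (ℕₚ.+-mono-≤ (ℕₚ.≤-trans (ℕₚ.≤-reflexive (length-elements B)) (tight-size t)) (length-concat ts))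
    go : ∀ r Bs → TightFamily x Bs → bs (f x) ≤ r + length Bs →
      ∃[ Q ] (length Q ≤ bs (f x) * width (f x) × (∀ y → Agree Q x y → f y ≡ f x))
    go r Bs fam le with search n (λ y → All.all? (λ v → lookup y v Boolₚ.≟ lookup x v) (concatMap elements Bs)
                                        ×-dec (f y Boolₚ.≟ not (f x)))
    ... | no none = concatMap elements Bs ,
      ℕₚ.≤-trans (length-concat (proj₂ fam)) (ℕₚ.*-monoˡ-≤ (width (f x)) (tight-family-bound fam)) ,
      λ y agree → ≢not (λ q → none (y , agree , q))
    ... | yes (y , agree , e) with separate x y e
    ...   | C , C⊆ , t = continue r le
      where
      fresh : ∀ {B v} → B ∈ˡ Bs → C v ≡ true → B v ≡ false
      fresh {B} {v} B∈ Cv with B v in Bv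
      ... | false = refl
      ... | true  = false≢true
        (diff-≡ x y (sym (All.lookup agree (∈-concatMap⁺ elements (lose B∈ (∈-elements {B = B} Bv)))))) (C⊆ v Cv)
      larger : TightFamily x (C ∷ Bs)
      larger = extend fam t (λ {B} {v} → fresh {B} {v})
      continue : ∀ r → bs (f x) ≤ r + length Bs → _
      continue zero    le = ⊥-elim (ℕₚ.<⇒≱ (tight-family-bound larger) le)
      continue (suc r) le = go r (C ∷ Bs) larger (ℕₚ.≤-trans le (ℕₚ.≤-reflexive (sym (ℕₚ.+-suc r (length Bs)))))

  -- Subcubes S are given by indicator functions.

  -- Degree at most e, with the values of g outside S left arbitrary.
  Computable : (Vec Bool n → Bool) → ℕ → Set
  Computable S e = ∃[ g ] (DegBelow (suc e) g × (∀ y → S y ≡ true → g y ≡ toℚ (f y)))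

  Determined : (Vec Bool n → Bool) → Fin n → Set
  Determined S v = ∀ y z → S y ≡ true → S z ≡ true → lookup y v ≡ lookup z v

  -- One step of a decision tree: with x_v as a 0/1 value, the answer polynomials combine to x_v g +
  -- (1 - x_v) h.
  query : ∀ {S} v {e} → Computable (λ y → S y ∧ lookup y v) e → Computable (λ y → S y ∧ not (lookup y v)) e →
    Computable S (suc e)
  query {S} v {e} (g , dg , eg) (h , dh , eh) =
    (λ y → (if lookup y v then g y else 0ℚ) +ℚ (if not (lookup y v) then h y else 0ℚ)) ,
    deg-+ (suc (suc e)) (deg-lit (suc e) (lit-lookup v) dg) (deg-lit (suc e) (lit-not (lit-lookup v)) dh) ,
    correct
    where
    correct : ∀ y → S y ≡ true →
      (if lookup y v then g y else 0ℚ) +ℚ (if not (lookup y v) then h y else 0ℚ) ≡ toℚ (f y)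
    correct y Sy with lookup y v in yv
    ... | true  = trans (ℚₚ.+-identityʳ (g y)) (eg y (cong₂ _∧_ Sy yv))
    ... | false = trans (ℚₚ.+-identityˡ (h y)) (eh y (cong₂ _∧_ Sy (cong not yv)))

  -- The hypothesis is a continuation: it handles each leaf, a subcube of S on which all queried
  -- variables are determined.
  query-all : ∀ vs S e → (∀ S′ → (∀ y → S′ y ≡ true → S y ≡ true) → All (Determined S′) vs → Computable S′ e) →
    Computable S (length vs + e)
  query-all []       S e H = H S (λ _ p → p) []
  query-all (v ∷ vs) S e H = query v
    (query-all vs _ e λ S′ sub det → H S′ (λ y p → proj₁ (∧-true (sub y p)))
      ((λ y z p q → trans (proj₂ (∧-true {S y} (sub y p))) (sym (proj₂ (∧-true {S z} (sub z q))))) ∷ det))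
    (query-all vs _ e λ S′ sub det → H S′ (λ y p → proj₁ (∧-true (sub y p)))
      ((λ y z p q → Boolₚ.not-injective (trans (proj₂ (∧-true {S y} (sub y p))) (sym (proj₂ (∧-true {S z} (sub z q)))))) ∷ det))

  zeroCertificate : ℕ
  zeroCertificate = bs false * width false

  -- The invariant after s certificate queries; each further one adds a block inside its variables.
  Explored : (Vec Bool n → Bool) → ℕ → Set
  Explored S s = ∀ y → S y ≡ true → f y ≡ true →
    ∃[ Bs ] (TightFamily y Bs × length Bs ≡ s × All (λ B → ∀ v → B v ≡ true → Determined S v) Bs)

  -- While S contains a 0-input z, the variables of its certificate are queried, after which every
  -- remaining 1-input gains a disjoint tight block; r rounds exhaust the bound `bs true`. Without a
  -- 0-input in S the constant 1 is correct.
  explore : ∀ r s S → bs true ≤ r + s → Explored S s → Computable S (r * zeroCertificate)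
  explore r s S le inv with search n (λ y → (S y Boolₚ.≟ true) ×-dec (f y Boolₚ.≟ false))
  ... | no none = (λ _ → 1ℚ) , deg-const n (r * zeroCertificate) 1ℚ ,
    λ y Sy → cong toℚ (sym (Boolₚ.¬-not (λ q → none (y , Sy , q))))
  ... | yes (z , Sz , fz) with certificate z
  ...   | Q , lenQ , cert = continue r le
    where
    -- The point y overwritten by z on Q satisfies the 0-certificate.
    patch : Vec Bool n → Vec Bool n
    patch y = tabulate (λ v → if does (v ∈? Q) then lookup z v else lookup y v)
    lookup-patch : ∀ y v → lookup (patch y) v ≡ (if does (v ∈? Q) then lookup z v else lookup y v)
    lookup-patch y = lookup∘tabulate _
    patch-false : ∀ y → f (patch y) ≡ false
    patch-false y = trans (cert (patch y) (All.tabulate λ {v} v∈ → trans (lookup-patch y v) (inside v v∈))) fz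
      where
      inside : ∀ v → v ∈ˡ Q → (if does (v ∈? Q) then lookup z v else lookup y v) ≡ lookup z v
      inside v v∈ with v ∈? Q
      ... | yes _  = refl
      ... | no  v∉ = ⊥-elim (v∉ v∈)
    diff-patch : ∀ y v → diff y (patch y) v ≡ true → v ∈ˡ Q × lookup y v ≢ lookup z v
    diff-patch y v d with v ∈? Q | lookup-patch y v
    ... | no  _  | e = false≢true (diff-≡ y (patch y) {v} (sym e)) d
    ... | yes v∈ | e = v∈ , λ q → false≢true (diff-≡ y (patch y) {v} (trans q (sym e))) d
    grow : ∀ y → S y ≡ true → f y ≡ true → ∃[ C ] ∃[ Bs ] (TightFamily y (C ∷ Bs) × length Bs ≡ s ×
      All (λ B → ∀ v → B v ≡ true → Determined S v) Bs × (∀ v → C v ≡ true → v ∈ˡ Q))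
    grow y Sy fy with inv y Sy fy | separate y (patch y) (trans (patch-false y) (cong not (sym fy)))
    ... | Bs , fam , len , inS | C , C⊆ , t =
      C , Bs , extend fam t (λ {B} {v} → fresh {B} {v}) , len , inS , λ v Cv → proj₁ (diff-patch y v (C⊆ v Cv))
      where
      fresh : ∀ {B v} → B ∈ˡ Bs → C v ≡ true → B v ≡ false
      fresh {B} {v} B∈ Cv with B v in Bv
      ... | false = refl
      -- A variable of an earlier block is determined on S, so y and z agree there, whereas they
      -- differ on all of C.
      ... | true  = ⊥-elim (proj₂ (diff-patch y v (C⊆ v Cv)) (All.lookup inS B∈ v Bv y z Sy Sz))
    further : ∀ S′ → (∀ y → S′ y ≡ true → S y ≡ true) → All (Determined S′) Q → Explored S′ (suc s)
    further S′ sub det y S′y fy with grow y (sub y S′y) fy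
    ... | C , Bs , fam , len , inS , inQ = C ∷ Bs , fam , cong suc len ,
      (λ v Cv → All.lookup det (inQ v Cv)) ∷
      All.map (λ d v Bv a b p q → d v Bv a b (sub a p) (sub b q)) inS
    continue : ∀ r → bs true ≤ r + s → Computable S (r * zeroCertificate)
    -- A remaining 1-input would carry more than `bs true` disjoint tight blocks, so f is 0 on S.
    continue zero le = (λ _ → 0ℚ) , deg-0 n 1 , λ y Sy → cong toℚ (sym (all-zero y Sy))
      where
      all-zero : ∀ y → S y ≡ true → f y ≡ false
      all-zero y Sy with f y in fy
      ... | false = refl
      ... | true with grow y Sy fy
      ...   | C , Bs , fam , refl , _ = ⊥-elim (ℕₚ.<⇒≱ (subst (λ c → length (C ∷ Bs) ≤ bs c) fy (tight-family-bound fam)) le)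
    continue (suc r) le with query-all Q S (r * zeroCertificate) (λ S′ sub det →
      explore r (suc s) S′ (ℕₚ.≤-trans le (ℕₚ.≤-reflexive (sym (ℕₚ.+-suc r s)))) (further S′ sub det))
    -- The certificate may be shorter than `zeroCertificate`; the degree is padded to that bound.
    ... | g , dg , eg = g , deg-≤ (s≤s (ℕₚ.+-monoˡ-≤ (r * zeroCertificate)
      (subst (λ c → length Q ≤ bs c * width c) fz lenQ))) dg , eg

  degree-bound : ∃[ g ] (DegBelow (suc (bs true * zeroCertificate)) g × (∀ y → g y ≡ toℚ (f y)))
  degree-bound with explore (bs true) 0 (λ _ → true) (ℕₚ.m≤m+n (bs true) 0) (λ y _ _ → [] , ([] , []) , refl , [])
  ... | g , dg , eg = g , dg , λ y → eg y refl

-- Multilinear coefficients and the final estimate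

-- Möbius inversion: the coefficient at S is the iterated discrete derivative of g in the directions
-- of S, taken at the origin.
coefficients : (Vec Bool n → ℚ) → Poly n
coefficients {zero}  g []          = g []
coefficients {suc n} g (false ∷ S) = coefficients (λ y → g (false ∷ y)) S
coefficients {suc n} g (true ∷ S)  = coefficients (λ y → g (true ∷ y) -ℚ g (false ∷ y)) S

eval-coefficients : (g : Vec Bool n → ℚ) → ∀ x → evalPoly (coefficients g) x ≡ g x
eval-coefficients {zero}  g [] = refl
eval-coefficients {suc n} g (false ∷ x) = trans (ℚₚ.+-identityʳ _) (eval-coefficients (λ y → g (false ∷ y)) x)
eval-coefficients {suc n} g (true ∷ x)  = trans
  (cong₂ _+ℚ_ (eval-coefficients (λ y → g (false ∷ y)) x) (eval-coefficients (λ y → g (true ∷ y) -ℚ g (false ∷ y)) x))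
  (solve 2 (λ a b → a :+ (b :- a) := b) refl (g (false ∷ x)) (g (true ∷ x)))

coefficients-0 : {g : Vec Bool n → ℚ} → (∀ y → g y ≡ 0ℚ) → ∀ S → coefficients g S ≡ 0ℚ
coefficients-0 {zero}  e []          = e []
coefficients-0 {suc n} e (false ∷ S) = coefficients-0 (λ y → e (false ∷ y)) S
coefficients-0 {suc n} e (true ∷ S)  = coefficients-0 (λ y → cong₂ _-ℚ_ (e (true ∷ y)) (e (false ∷ y))) S

coefficients-degree : ∀ d {g : Vec Bool n → ℚ} → DegBelow d g →
  ∀ S → d ≤ count (Boolₚ._≟ true) S → coefficients g S ≡ 0ℚ
coefficients-degree         zero    p       S           _        = coefficients-0 p S
coefficients-degree {suc n} (suc d) (p , _) (false ∷ S) le       = coefficients-degree (suc d) p S le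
coefficients-degree {suc n} (suc d) (_ , q) (true ∷ S)  (s≤s le) = coefficients-degree d q S le

^-distrib-* : ∀ a b m → a ^ m * b ^ m ≡ (a * b) ^ m
^-distrib-* a b zero    = refl
^-distrib-* a b (suc m) = trans (interchange ℕₚ.*-commutativeSemigroup a (a ^ m) b (b ^ m)) (cong (a * b *_) (^-distrib-* a b m))

-- The left side is `bs true * zeroCertificate` written out, with s for the 16 in `L`. It equals s⁵
-- k⁵ a⁶ b⁴, and k⁵ is at most k (k + 1)² (2k + 1)².
product-bound : ∀ s k a b →
  k * (k * 1 * (s * (b * b))) * (s * (a * a)) * (k * (k * 1 * (s * (a * a))) * (s * (b * b)) * (k * 1 * (s * (a * a))))
    ≤ (s * s * s * s * s) * (k * (k + 1) ^ 2 * (2 * k + 1) ^ 2 * (a * b) ^ 6)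
product-bound s k a b = begin
  k * (k * 1 * (s * (b * b))) * (s * (a * a)) * (k * (k * 1 * (s * (a * a))) * (s * (b * b)) * (k * 1 * (s * (a * a))))
    ≡⟨ regroup s k a b ⟩
  (s * s * s * s * s) * (k * k ^ 2 * k ^ 2 * (a ^ 6 * b ^ 4))
    ≤⟨ ℕₚ.*-monoʳ-≤ (s * s * s * s * s) (ℕₚ.*-mono-≤
         (ℕₚ.*-mono-≤ (ℕₚ.*-monoʳ-≤ k (ℕₚ.^-monoˡ-≤ 2 (ℕₚ.m≤m+n k 1)))
           (ℕₚ.^-monoˡ-≤ 2 (ℕₚ.≤-trans (ℕₚ.m≤m+n k (k + 0)) (ℕₚ.m≤m+n (2 * k) 1))))
         (ℕₚ.≤-trans (ℕₚ.*-monoʳ-≤ (a ^ 6) (b⁴≤b⁶ b)) (ℕₚ.≤-reflexive (^-distrib-* a b 6)))) ⟩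
  (s * s * s * s * s) * (k * (k + 1) ^ 2 * (2 * k + 1) ^ 2 * (a * b) ^ 6) ∎
  where
  open ℕₚ.≤-Reasoning
  b⁴≤b⁶ : ∀ b → b ^ 4 ≤ b ^ 6
  b⁴≤b⁶ zero    = z≤n
  b⁴≤b⁶ (suc b) = ℕₚ.^-monoʳ-≤ (suc b) (ℕₚ.m≤m+n 4 2)
  -- The powers are unfolded because the solver does not interpret _^_.
  regroup : ∀ s k a b →
    k * (k * 1 * (s * (b * b))) * (s * (a * a)) * (k * (k * 1 * (s * (a * a))) * (s * (b * b)) * (k * 1 * (s * (a * a))))
      ≡ (s * s * s * s * s) * (k * (k * (k * 1)) * (k * (k * 1)) *
        (a * (a * (a * (a * (a * (a * 1))))) * (b * (b * (b * (b * 1))))))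
  regroup = solve-∀

theorem3 : ∃[ C ] (∀ (n k : ℕ) (φ : DNF n) (f : BoolFun n) →
    Computes φ f → ReadK k φ → Minimal φ → ¬ IsConstant f →
    ∀ (d a b : ℕ) → IsApproxDeg f d → IsNDeg f a → IsNDeg (compl f) b →
    d ≤ C * (k * (k + 1) ^ 2 * (2 * k + 1) ^ 2 * (a * b) ^ 6))
-- The degree bound contains five factors `L`, each with the constant 16.
theorem3 = 16 * 16 * 16 * 16 * 16 , λ n k φ f comp rk _ _ d a b → λ where
    (_ , least) ((p , degp , sep-p) , _) ((q , degq , sep-q) , _) →
      let deg = λ (c : Bool) → if c then a else b
          witness = λ where
            true  → p , degp , λ x → proj₂ (sep-p x) , proj₁ (sep-p x)
            false → q , degq , λ x → (λ e → proj₂ (sep-q x) (cong not e)) , (λ e → proj₁ (sep-q x) (cong not e))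
          open Sensitivity φ f comp rk deg witness using (L; family-bound)
          (g , dg , eg) = Certificates.degree-bound f k L family-bound
      in ℕₚ.≤-trans
        -- The polynomial represents f exactly, so its error 0 is within 1/3 and the minimality of d
        -- applies.
        (least _ (coefficients g) (coefficients-degree _ dg) λ x →
          subst (_≤ℚ ⅓) (cong ∣_∣ (trans (sym (ℚₚ.+-inverseʳ (toℚ (f x))))
              (cong (toℚ (f x) -ℚ_) (sym (trans (eval-coefficients g x) (eg x))))))
            (ℚₚ.nonNegative⁻¹ ⅓))
        (product-bound 16 k a b)
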